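{- The configuration-LP for the Restricted Assignment problem has an integrality gap of at most $2 - 1/6 = 11/6$. That is, for every instance of Restricted Assignment, if $\mathrm{OPT}$ denotes the minimum makespan of a schedule and $\mathrm{OPT}^*$ denotes the minimum $T$ for which the configuration-LP with target makespan $T$ is feasible, then $\mathrm{OPT} \le (2 - 1/6)\,\mathrm{OPT}^*$.
   Context: An instance of Restricted Assignment consists of a finite set of jobs $\mathcal J$ and a finite set of machines $\mathcal M$; each job $j$ has a processing time $p_j \ge 0$ and a nonempty set $\Gamma(j)\subseteq\mathcal M$ of machines on which it is allowed, so that $p_{ij}=p_j$ if $i\in\Gamma(j)$ and $p_{ij}=\infty$ otherwise. A schedule is a function $\sigma:\mathcal J\to\mathcal M$ with $\sigma(j)\in\Gamma(j)$ for all $j$; its makespan is $\max_{i\in\mathcal M}\sum_{j\in\sigma^{ -1}(i)} p_{ij}$, and $\mathrm{OPT}$ is the minimum makespan over all schedules. For a target makespan $T$ and machine $i$, the set of configurations is $\mathcal C_i(T)=\{C\subseteq\mathcal J : \sum_{j\in C}p_{ij}\le T\}$. The configuration-LP for $T$ is the feasibility problem in variables $x_{i,C}\ge 0$ ($i\in\mathcal M$, $C\in\mathcal C_i(T)$): $\sum_{C\in\mathcal C_i(T)}x_{i,C}\le 1$ for all $i\in\mathcal M$, and $\sum_{i\in\mathcal M}\sum_{C\in\mathcal C_i(T):\, j\in C}x_{i,C}\ge 1$ for all $j\in\mathcal J$. $\mathrm{OPT}^*$ is the minimal $T$ for which this LP is feasible. The integrality gap is the supremum over instances of $\mathrm{O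PT}/\mathrm{OPT}^*$.
   Formalization: The processing times, the target makespan T and the variables of the configuration-LP are rational numbers instead of real numbers. -}

module Defs where

open import Data.Bool using (Bool; true; false; if_then_else_; _∧_)
open import Data.Nat using (ℕ; zero; suc)
open import Data.Fin using (Fin)
open import Data.Fin.Properties using (_≟_)
open import Data.Fin.Subset using (Subset; _∈_)
open import Data.Vec using (Vec; []; _∷_; lookup)
open import Data.List using (List; []; _∷_; map; foldr; _++_; allFin)
open import Data.Rational using (ℚ; 0ℚ; _+_; _*_; _≤_; _≤ᵇ_; _/_)
open import Data.Integer using (+_)
open import Data.Product using (Σ; ∃; _×_)
open import Relation.Binary.PropositionalEquality using (_≡_)
open import Relation.Nullary.Decidable using (⌊_⌋)

sumℚ : List ℚ → ℚ
sumℚ = foldr _+_ 0ℚ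

Σℚ : ∀ {n} → (Fin n → ℚ) → ℚ
Σℚ {n} f = sumℚ (map f (allFin n))

allSubsets : ∀ n → List (Subset n)
allSubsets zero = [] ∷ []
allSubsets (suc n) = map (false ∷_) (allSubsets n) ++ map (true ∷_) (allSubsets n)

-- An instance of Restricted Assignment with n jobs (Fin n) and m machines (Fin m):
-- processing times p j ≥ 0 and nonempty allowed sets Γ j ⊆ machines.
record Instance (n m : ℕ) : Set where
  field
    p        : Fin n → ℚ
    p≥0      : ∀ j → 0ℚ ≤ p j
    Γ        : Fin n → Subset m
    Γ≠∅      : ∀ j → ∃ λ i → i ∈ Γ j

module _ {n m : ℕ} (I : Instance n m) where
  open Instance I

  allowedᵇ : Fin m → Fin n → Bool
  allowedᵇ i j = lookup (Γ j) i

  -- C ∈ C_i(T): all jobs of C are allowed on i (otherwise p_ij = ∞ and the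
  -- sum is infinite) and Σ_{j ∈ C} p_j ≤ T.
  allAllowedᵇ : Fin m → Subset n → Bool
  allAllowedᵇ i C = foldr _∧_ true
    (map (λ j → if lookup C j then allowedᵇ i j else true) (allFin n))

  configLoad : Subset n → ℚ
  configLoad C = Σℚ (λ j → if lookup C j then p j else 0ℚ)

  isConfigᵇ : ℚ → Fin m → Subset n → Bool
  isConfigᵇ T i C = allAllowedᵇ i C ∧ (configLoad C ≤ᵇ T)

  ΣConfigs : ℚ → Fin m → (Subset n → ℚ) → ℚ
  ΣConfigs T i f = sumℚ (map (λ C → if isConfigᵇ T i C then f C else 0ℚ) (allSubsets n))

  -- x is a feasible solution of the configuration-LP for target T.
  -- (Values of x on non-configurations are irrelevant.)
  ConfigLPSolution : ℚ → (Fin m → Subset n → ℚ) → Set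
  ConfigLPSolution T x =
      (∀ i C → 0ℚ ≤ x i C)
    × (∀ i → ΣConfigs T i (x i) ≤ 1ℚ')
    × (∀ j → 1ℚ' ≤ Σℚ (λ i → ΣConfigs T i (λ C → if lookup C j then x i C else 0ℚ)))
    where 1ℚ' = + 1 / 1

  ConfigLPFeasible : ℚ → Set
  ConfigLPFeasible T = ∃ λ x → ConfigLPSolution T x

  Schedule : Set
  Schedule = Σ (Fin n → Fin m) λ σ → ∀ j → σ j ∈ Γ j

  -- Load of machine i under σ (all assigned jobs are allowed, so p_ij = p_j).
  load : (Fin n → Fin m) → Fin m → ℚ
  load σ i = Σℚ (λ j → if ⌊ σ j ≟ i ⌋ then p j else 0ℚ)

  MakespanAtMost : (Fin n → Fin m) → ℚ → Set
  MakespanAtMost σ B = ∀ i → load σ i ≤ B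

elevenSixths : ℚ
elevenSixths = + 11 / 6

{-# OPTIONS --safe #-}
module Submission where

-- Scale so that T = 6τ and all sizes are naturals; a job is small if its size is at most 3τ.  Jobs are inserted
-- one at a time by local search.  A stack of blockers records moves that are wanted but do not fit in 11τ, and
-- each blocker activates jobs whose departure from the target machine would help.  When an active job can be moved,
-- the move is carried out and the blocker that activated the job improves, so stacks decrease lexicographically.
-- When nothing more can be done, the LP dual is violated: let z j = min (w j, 5τ) on the active and immovable
-- jobs and 0 on the others, and let y i = 6τ on the machines all of whose jobs were activated and
-- y i = z (σ⁻¹ i) on the others.  A machine that refuses a small job has load above 8τ, hence z-value at least 7τ;
-- one that refuses only big jobs has z-value at least 5τ, and its deficit τ is paid by a machine of the first kind.
-- The unassigned job then makes ∑ z > ∑ y, although z (C) ≤ y i for all configurations C.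

open import Defs
open import Algebra.Bundles using (CommutativeMonoid)
open import Algebra.Properties.CommutativeMonoid.Sum using (sum; sum-cong-≗; ∑-distrib-+; ∑-comm)
open import Algebra.Properties.CommutativeSemigroup using (interchange)
open import Data.Bool using (Bool; true; false; if_then_else_; _∧_)
open import Data.Bool.Properties using (T-≡)
open import Data.Empty using (⊥)
open import Data.Fin using (Fin; zero; suc; toℕ)
open import Data.Fin.Properties using (_≟_; all?; any?; toℕ-injective; toℕ<n)
open import Data.Fin.Subset using (Subset; _∈_)
open import Data.Fin.Subset.Properties using (_∈?_)
open import Data.List using (List; []; _∷_; map; allFin; tabulate; foldr)
open import Data.List.Membership.Propositional using () renaming (_∈_ to _∈ᴸ_)
open import Data.List.Membership.Propositional.Properties using (∈-allFin)
open import Data.List.Properties using (map-tabulate)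
open import Data.List.Relation.Unary.Any using (here; there)
open import Data.Maybe using (Maybe; just; nothing)
open import Data.Maybe.Properties using (≡-dec; just-injective)
open import Data.Nat using (ℕ)
open import Data.Product using (Σ; ∃; _×_; _,_; proj₁; proj₂; map₂)
open import Data.Product.Relation.Binary.Lex.Strict using (×-Lex; ×-wellFounded)
open import Data.Sum as Sum using (_⊎_; inj₁; inj₂)
open import Data.Unit using (⊤; tt)
open import Data.Vec using (lookup)
open import Data.Vec.Functional using (updateAt)
open import Data.Vec.Functional.Properties using (updateAt-updates; updateAt-minimal)
open import Data.Vec.Properties using (lookup⇒[]=; []=⇒lookup)
open import Function using (_∘_; const; id)
open import Function.Bundles using (Equivalence)
open import Induction.WellFounded using (Acc; acc; WellFounded)
open import Level using (0ℓ)
open import Relation.Binary.PropositionalEquality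
  using (_≡_; _≢_; refl; sym; trans; cong; cong₂; subst; subst₂; module ≡-Reasoning)
open import Relation.Nullary using (¬_; Dec; yes; no; contradiction; ¬?; _×-dec_; _⊎-dec_; _→-dec_)
open import Relation.Nullary.Decidable using (⌊_⌋)
open import Relation.Unary using (Pred; Decidable)

-- Why 11/6: write Rτ for the permitted load. Two jobs above 3τ never share a configuration, which
-- fixes the threshold for small jobs. If C contains an active big job j that is not on machine i,
-- then z (C) + w j ≤ 6τ + cap; for a refusal of j (stuck load plus w j above Rτ) to yield z (C) ≤ z
-- (σ⁻¹ i), the cap should be (R - 6)τ. With this cap, a machine that refuses a small job keeps
-- z-value (R - 3)τ minus the capping loss (12 - R)τ, and one that refuses only big jobs keeps (R -
-- 6)τ. A pair of them has to cover 2 · 6τ, so 3R - 21 ≥ 12, that is R ≥ 11. The obstacle is the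
-- loss on machines fully activated for a big job. Such activation therefore waits until the stuck
-- jobs and all big jobs there would leave room. Before that only big jobs are activated, and a
-- machine without full activation is charged just its own z-value.

module Sums where

  open import Data.Nat using (zero; suc; _+_; _≤_; _<_; z≤n)
  open import Data.Nat.Properties hiding (_≟_)

  -- Sums of naturals restricted to decidable predicates

  ∑ : ∀ {n} → (Fin n → ℕ) → ℕ
  ∑ = sum +-0-commutativeMonoid

  ∑-+ : ∀ {n} (f g : Fin n → ℕ) → ∑ (λ x → f x + g x) ≡ ∑ f + ∑ g
  ∑-+ = ∑-distrib-+ +-0-commutativeMonoid

  ∑-mono : ∀ {n} {f g : Fin n → ℕ} → (∀ x → f x ≤ g x) → ∑ f ≤ ∑ g
  ∑-mono {zero}  f≤g = z≤n
  ∑-mono {suc n} f≤g = +-mono-≤ (f≤g zero) (∑-mono (f≤g ∘ suc))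

  ∑-mono-< : ∀ {n} {f g : Fin n → ℕ} → (∀ x → f x ≤ g x) → ∀ y → f y < g y → ∑ f < ∑ g
  ∑-mono-< f≤g zero    fy<gy = +-mono-<-≤ fy<gy (∑-mono (f≤g ∘ suc))
  ∑-mono-< f≤g (suc y) fy<gy = +-mono-≤-< (f≤g zero) (∑-mono-< (f≤g ∘ suc) y fy<gy)

  ∑-zero : ∀ n → ∑ {n} (λ _ → 0) ≡ 0
  ∑-zero zero    = refl
  ∑-zero (suc n) = ∑-zero n

  infix 7 _when_

  _when_ : ∀ {P : Set} → ℕ → Dec P → ℕ
  x when yes _ = x
  x when no  _ = 0

  when-yes : ∀ {P : Set} {x} (P? : Dec P) → P → x when P? ≡ x
  when-yes (yes _) p = refl
  when-yes (no ¬p) p = contradiction p ¬p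

  when-no : ∀ {P : Set} {x} (P? : Dec P) → ¬ P → x when P? ≡ 0
  when-no (yes p) ¬p = contradiction p ¬p
  when-no (no _)  ¬p = refl

  when-≤ : ∀ {P : Set} {x} (P? : Dec P) → x when P? ≤ x
  when-≤ (yes _) = ≤-refl
  when-≤ (no _)  = z≤n

  when-≤ʳ : ∀ {P : Set} {x y} (P? : Dec P) → (P → x ≤ y) → x when P? ≤ y
  when-≤ʳ (yes p) x≤y = x≤y p
  when-≤ʳ (no _)  x≤y = z≤n

  when-mono : ∀ {P Q : Set} {x} (P? : Dec P) (Q? : Dec Q) → (P → Q) → x when P? ≤ x when Q?
  when-mono P? Q? P⇒Q = when-≤ʳ P? (λ p → ≤-reflexive (sym (when-yes Q? (P⇒Q p))))

  ∑-at : ∀ {n} a (j : Fin n) → ∑ (λ x → a when (x ≟ j)) ≡ a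
  ∑-at {suc n} a zero    = trans (cong (a +_) (∑-zero n)) (+-identityʳ a)
  ∑-at {suc n} a (suc j) = trans (sum-cong-≗ +-0-commutativeMonoid when-suc) (∑-at a j)
    where
    when-suc : ∀ x → a when (suc x ≟ suc j) ≡ a when (x ≟ j)
    when-suc x with x ≟ j
    ... | yes _ = refl
    ... | no  _ = refl

  module _ {n : ℕ} (f : Fin n → ℕ) where

    ∑∣ : {P : Pred (Fin n) 0ℓ} → Decidable P → ℕ
    ∑∣ P? = ∑ (λ x → f x when P? x)

    module _ {P Q : Pred (Fin n) 0ℓ} (P? : Decidable P) (Q? : Decidable Q) where

      ∑∣-mono : (∀ x → P x → Q x) → ∑∣ P? ≤ ∑∣ Q?
      ∑∣-mono P⊆Q = ∑-mono (λ x → when-mono (P? x) (Q? x) (P⊆Q x))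

      ∑∣-mono-< : (∀ x → P x → Q x) → ∀ y → ¬ P y → Q y → 0 < f y → ∑∣ P? < ∑∣ Q?
      ∑∣-mono-< P⊆Q y ¬Py Qy 0<fy = ∑-mono-< (λ x → when-mono (P? x) (Q? x) (P⊆Q x)) y
        (subst₂ _<_ (sym (when-no (P? y) ¬Py)) (sym (when-yes (Q? y) Qy)) 0<fy)

    ∑∣-cong : {P Q : Pred (Fin n) 0ℓ} (P? : Decidable P) (Q? : Decidable Q) →
              (∀ x → P x → Q x) → (∀ x → Q x → P x) → ∑∣ P? ≡ ∑∣ Q?
    ∑∣-cong P? Q? P⊆Q Q⊆P = ≤-antisym (∑∣-mono P? Q? P⊆Q) (∑∣-mono Q? P? Q⊆P)

    ∑∣-none : {P : Pred (Fin n) 0ℓ} (P? : Decidable P) → (∀ x → ¬ P x) → ∑∣ P? ≡ 0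
    ∑∣-none P? ∄P = n≤0⇒n≡0 (≤-trans (∑-mono (λ x → ≤-reflexive (when-no (P? x) (∄P x)))) (≤-reflexive (∑-zero n)))

  two-members : ∀ {n} (f : Fin n → ℕ) {P : Pred (Fin n) 0ℓ} (P? : Decidable P) {j k} →
                j ≢ k → P j → P k → f j + f k ≤ ∑∣ f P?
  two-members f P? {j} {k} j≢k Pj Pk = begin
    f j + f k                                                    ≡⟨ cong₂ _+_ (∑-at (f j) j) (∑-at (f k) k) ⟨
    ∑ (λ x → f j when (x ≟ j)) + ∑ (λ x → f k when (x ≟ k))      ≡⟨ ∑-+ (λ x → f j when (x ≟ j)) _ ⟨
    ∑ (λ x → f j when (x ≟ j) + f k when (x ≟ k))                ≤⟨ ∑-mono pointwise ⟩
    ∑∣ f P?                                                      ∎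
    where
    open ≤-Reasoning
    pointwise : ∀ x → f j when (x ≟ j) + f k when (x ≟ k) ≤ f x when P? x
    pointwise x with x ≟ j | x ≟ k
    ... | yes refl | yes refl = contradiction refl j≢k
    ... | yes refl | no _     = ≤-reflexive (trans (+-identityʳ _) (sym (when-yes (P? x) Pj)))
    ... | no _     | yes refl = ≤-reflexive (sym (when-yes (P? x) Pk))
    ... | no _     | no _     = z≤n

  ∑∣-member : ∀ {n} (f : Fin n → ℕ) {P : Pred (Fin n) 0ℓ} (P? : Decidable P) {j} → P j → f j ≤ ∑∣ f P?
  ∑∣-member f P? {j} Pj = ≤-trans (≤-reflexive (sym (∑-at (f j) j))) (∑-mono pointwise)
    where
    pointwise : ∀ x → f j when (x ≟ j) ≤ f x when P? x
    pointwise x with x ≟ j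
    ... | yes refl = ≤-reflexive (sym (when-yes (P? x) Pj))
    ... | no _     = z≤n

  -- Linear arithmetic without subtraction: the hypotheses are added up to one inequality `a ≤ b`,
  -- and the ring solver supplies the equation.
  ≤-from-sum : ∀ {x y a b} → a ≤ b → x + b ≡ y + a → x ≤ y
  ≤-from-sum {x} {y} {a} {b} a≤b eq = +-cancelʳ-≤ b x y (≤-trans (≤-reflexive eq) (+-monoʳ-≤ y a≤b))

  argmin : ∀ {n} (f : Fin n → ℕ) {P : Pred (Fin n) 0ℓ} → Decidable P →
           (∀ x → ¬ P x) ⊎ ∃ λ k → P k × (∀ x → P x → f k ≤ f x)
  argmin {zero}  f P? = inj₁ λ ()
  argmin {suc n} f P? with argmin (f ∘ suc) (P? ∘ suc) | P? zero
  ... | inj₁ ∄P            | no ¬P₀ = inj₁ λ { zero → ¬P₀ ; (suc x) → ∄P x }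
  ... | inj₁ ∄P            | yes P₀ = inj₂ (zero , P₀ , λ { zero _ → ≤-refl ; (suc x) Px → contradiction Px (∄P x) })
  ... | inj₂ (k , Pk , k≤) | no ¬P₀ = inj₂ (suc k , Pk , λ { zero P₀ → contradiction P₀ ¬P₀ ; (suc x) → k≤ x })
  ... | inj₂ (k , Pk , k≤) | yes P₀ with ≤-total (f zero) (f (suc k))
  ...   | inj₁ 0≤k = inj₂ (zero , P₀ , λ { zero _ → ≤-refl ; (suc x) Px → ≤-trans 0≤k (k≤ x Px) })
  ...   | inj₂ k≤0 = inj₂ (suc k , Pk , λ { zero _ → k≤0 ; (suc x) → k≤ x })

-- Partial schedules, blockers and stuck jobs

module Search {n m : ℕ} (w : Fin n → ℕ) (Γ : Fin n → Subset m) (τ : ℕ) where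

  open Sums
  open import Data.Nat using (zero; suc; _+_; _*_; _≤_; _<_; z≤n; s≤s; _⊓_; _≤?_; _<?_)
  open import Data.Nat.Induction using (<-wellFounded)
  open import Data.Nat.Properties hiding (_≟_)
  open import Data.Nat.Tactic.RingSolver using (solve-∀)

  Partial : Set
  Partial = Fin n → Maybe (Fin m)

  Small Big : Fin n → Set
  Small j = w j ≤ 3 * τ
  Big   j = 3 * τ < w j

  On : Partial → Fin m → Fin n → Set
  On σ i j = σ j ≡ just i

  on? : ∀ σ i → Decidable (On σ i)
  on? σ i j = ≡-dec _≟_ (σ j) (just i)

  BigOn : Partial → Fin m → Fin n → Set
  BigOn σ i j = Big j × On σ i j

  bigOn? : ∀ σ i → Decidable (BigOn σ i)
  bigOn? σ i j = (3 * τ <? w j) ×-dec on? σ i j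

  fullLoad bigLoad count bigCount : Partial → Fin m → ℕ
  fullLoad σ i = ∑∣ w (on? σ i)
  bigLoad  σ i = ∑∣ w (bigOn? σ i)
  count    σ i = ∑∣ (λ _ → 1) (on? σ i)
  bigCount σ i = ∑∣ (λ _ → 1) (bigOn? σ i)

  Feasible : Partial → Set
  Feasible σ = (∀ j i → On σ i j → i ∈ Γ j) × (∀ i → fullLoad σ i ≤ 11 * τ)

  -- Orders the jobs by size, with ties broken by index.
  key : Fin n → ℕ
  key j = w j * n + toℕ j

  key-≤⇒w-≤ : ∀ {j k} → key j ≤ key k → w j ≤ w k
  key-≤⇒w-≤ {j} {k} key≤ = ≮⇒≥ λ wk<wj → <⇒≱ (begin-strict
    w k * n + toℕ k <⟨ +-monoʳ-< (w k * n) (toℕ<n k) ⟩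
    w k * n + n     ≡⟨ +-comm (w k * n) n ⟩
    suc (w k) * n   ≤⟨ *-monoˡ-≤ n wk<wj ⟩
    w j * n         ≤⟨ m≤m+n _ _ ⟩
    key j           ∎) key≤
    where open ≤-Reasoning

  key-injective : ∀ {j k} → key j ≡ key k → j ≡ k
  key-injective {j} {k} eq = toℕ-injective
    (+-cancelˡ-≡ (w j * n) _ _ (trans eq (cong (λ v → v * n + toℕ k) wk≡wj)))
    where
    wk≡wj : w k ≡ w j
    wk≡wj = ≤-antisym (key-≤⇒w-≤ (≤-reflexive (sym eq))) (key-≤⇒w-≤ (≤-reflexive eq))

  LeastBig : Partial → Fin m → Fin n → Set
  LeastBig σ i k = BigOn σ i k × (∀ k′ → BigOn σ i k′ → key k ≤ key k′)

  -- Small-to-any, big-to-any, big-to-big and big-to-least: the job wants to move to the machine, and activates all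
  -- jobs there (sa, ba), the big jobs there (bb), or only the least big job there (bl, where it is the last argument).
  -- The number bounds how many jobs are activated; storing it makes the progress measure independent of the
  -- schedule.  Lists of blockers have the most recent one first.
  data Blocker : Set where
    sa ba bb : Fin n → Fin m → ℕ → Blocker
    bl       : Fin n → Fin m → Fin n → Blocker

  job : Blocker → Fin n
  job (sa j _ _) = j
  job (ba j _ _) = j
  job (bb j _ _) = j
  job (bl j _ _) = j

  mach : Blocker → Fin m
  mach (sa _ i _) = i
  mach (ba _ i _) = i
  mach (bb _ i _) = i
  mach (bl _ i _) = i

  Full BigBlocked : List Blocker → Fin m → Set
  Full []               i = ⊥
  Full (sa _ i′ _ ∷ Bs) i = i ≡ i′ ⊎ Full Bs i
  Full (ba _ i′ _ ∷ Bs) i = i ≡ i′ ⊎ Full Bs i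
  Full (bb _ _  _ ∷ Bs) i = Full Bs i
  Full (bl _ _  _ ∷ Bs) i = Full Bs i

  BigBlocked []               i = ⊥
  BigBlocked (sa _ _  _ ∷ Bs) i = BigBlocked Bs i
  BigBlocked (ba _ _  _ ∷ Bs) i = BigBlocked Bs i
  BigBlocked (bb _ i′ _ ∷ Bs) i = i ≡ i′ ⊎ BigBlocked Bs i
  BigBlocked (bl _ _  _ ∷ Bs) i = BigBlocked Bs i

  LeastBlocked : List Blocker → Fin m → Fin n → Set
  LeastBlocked []                i k = ⊥
  LeastBlocked (sa _ _  _  ∷ Bs) i k = LeastBlocked Bs i k
  LeastBlocked (ba _ _  _  ∷ Bs) i k = LeastBlocked Bs i k
  LeastBlocked (bb _ _  _  ∷ Bs) i k = LeastBlocked Bs i k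
  LeastBlocked (bl _ i′ k′ ∷ Bs) i k = (i ≡ i′ × k ≡ k′) ⊎ LeastBlocked Bs i k

  full? : ∀ Bs → Decidable (Full Bs)
  full? []               i = no λ ()
  full? (sa _ i′ _ ∷ Bs) i = (i ≟ i′) ⊎-dec full? Bs i
  full? (ba _ i′ _ ∷ Bs) i = (i ≟ i′) ⊎-dec full? Bs i
  full? (bb _ _  _ ∷ Bs) i = full? Bs i
  full? (bl _ _  _ ∷ Bs) i = full? Bs i

  bigBlocked? : ∀ Bs → Decidable (BigBlocked Bs)
  bigBlocked? []               i = no λ ()
  bigBlocked? (sa _ _  _ ∷ Bs) i = bigBlocked? Bs i
  bigBlocked? (ba _ _  _ ∷ Bs) i = bigBlocked? Bs i
  bigBlocked? (bb _ i′ _ ∷ Bs) i = (i ≟ i′) ⊎-dec bigBlocked? Bs i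
  bigBlocked? (bl _ _  _ ∷ Bs) i = bigBlocked? Bs i

  leastBlocked? : ∀ Bs i → Decidable (LeastBlocked Bs i)
  leastBlocked? []                i k = no λ ()
  leastBlocked? (sa _ _  _  ∷ Bs) i k = leastBlocked? Bs i k
  leastBlocked? (ba _ _  _  ∷ Bs) i k = leastBlocked? Bs i k
  leastBlocked? (bb _ _  _  ∷ Bs) i k = leastBlocked? Bs i k
  leastBlocked? (bl _ i′ k′ ∷ Bs) i k = ((i ≟ i′) ×-dec (k ≟ k′)) ⊎-dec leastBlocked? Bs i k

  full-∷ : ∀ B {Bs i} → Full Bs i → Full (B ∷ Bs) i
  full-∷ (sa _ _ _) f = inj₂ f
  full-∷ (ba _ _ _) f = inj₂ f
  full-∷ (bb _ _ _) f = f
  full-∷ (bl _ _ _) f = f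

  bigBlocked-∷ : ∀ B {Bs i} → BigBlocked Bs i → BigBlocked (B ∷ Bs) i
  bigBlocked-∷ (sa _ _ _) b = b
  bigBlocked-∷ (ba _ _ _) b = b
  bigBlocked-∷ (bb _ _ _) b = inj₂ b
  bigBlocked-∷ (bl _ _ _) b = b

  leastBlocked-∷ : ∀ B {Bs i k} → LeastBlocked Bs i k → LeastBlocked (B ∷ Bs) i k
  leastBlocked-∷ (sa _ _ _) b = b
  leastBlocked-∷ (ba _ _ _) b = b
  leastBlocked-∷ (bb _ _ _) b = b
  leastBlocked-∷ (bl _ _ _) b = inj₂ b

  -- All alternatives of a stuck job are full, so it can be counted on to stay.
  Stuck : Partial → List Blocker → Fin m → Fin n → Set
  Stuck σ Bs i j = Small j × On σ i j × (∀ i′ → i′ ∈ Γ j → i′ ≡ i ⊎ Full Bs i′)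

  stuck? : ∀ σ Bs i → Decidable (Stuck σ Bs i)
  stuck? σ Bs i j = (w j ≤? 3 * τ) ×-dec on? σ i j ×-dec
    all? (λ i′ → (i′ ∈? Γ j) →-dec ((i′ ≟ i) ⊎-dec full? Bs i′))

  stuckLoad : Partial → List Blocker → Fin m → ℕ
  stuckLoad σ Bs i = ∑∣ w (stuck? σ Bs i)

  move : Partial → Fin n → Fin m → Partial
  move σ j i = updateAt σ j (const (just i))

  move-at : ∀ σ j i → On (move σ j i) i j
  move-at σ j i = updateAt-updates j σ

  move-away : ∀ σ j i {x} → x ≢ j → move σ j i x ≡ σ x
  move-away σ j i {x} x≢j = updateAt-minimal x j σ x≢j

  moved-on : ∀ σ j i i′ → i′ ≢ i → ∀ x → On (move σ j i) i′ x → On σ i′ x × x ≢ j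
  moved-on σ j i i′ i′≢i x on = trans (sym (move-away σ j i x≢j)) on , x≢j
    where
    x≢j : x ≢ j
    x≢j refl = i′≢i (just-injective (trans (sym on) (move-at σ j i)))

  fullLoad-move : ∀ σ j i → fullLoad (move σ j i) i ≤ fullLoad σ i + w j
  fullLoad-move σ j i = begin
    fullLoad (move σ j i) i                          ≤⟨ ∑-mono pointwise ⟩
    ∑ (λ x → w x when on? σ i x + w j when (x ≟ j))  ≡⟨ ∑-+ (λ x → w x when on? σ i x) _ ⟩
    fullLoad σ i + ∑ (λ x → w j when (x ≟ j))        ≡⟨ cong (fullLoad σ i +_) (∑-at (w j) j) ⟩
    fullLoad σ i + w j                               ∎
    where
    open ≤-Reasoning
    pointwise : ∀ x → w x when on? (move σ j i) i x ≤ w x when on? σ i x + w j when (x ≟ j)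
    pointwise x with x ≟ j
    ... | yes refl = ≤-trans (when-≤ (on? (move σ j i) i j)) (m≤n+m (w j) _)
    ... | no x≢j   = ≤-trans
      (when-mono (on? (move σ j i) i x) (on? σ i x) (trans (sym (move-away σ j i x≢j)))) (m≤m+n _ 0)

  fullLoad-move-≤ : ∀ σ j i i′ → i′ ≢ i → fullLoad (move σ j i) i′ ≤ fullLoad σ i′
  fullLoad-move-≤ σ j i i′ i′≢i =
    ∑∣-mono w (on? (move σ j i) i′) (on? σ i′) (λ x → proj₁ ∘ moved-on σ j i i′ i′≢i x)

  feasible-move : ∀ {σ j i} → Feasible σ → i ∈ Γ j → fullLoad σ i + w j ≤ 11 * τ → Feasible (move σ j i)
  feasible-move {σ} {j} {i} (σ∈Γ , σ≤) i∈Γj fits = σ′∈Γ , σ′≤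
    where
    σ′∈Γ : ∀ x i′ → On (move σ j i) i′ x → i′ ∈ Γ x
    σ′∈Γ x i′ on with x ≟ j
    ... | yes refl = subst (_∈ Γ j) (just-injective (trans (sym (move-at σ j i)) on)) i∈Γj
    ... | no x≢j   = σ∈Γ x i′ (trans (sym (move-away σ j i x≢j)) on)
    σ′≤ : ∀ i′ → fullLoad (move σ j i) i′ ≤ 11 * τ
    σ′≤ i′ with i′ ≟ i
    ... | yes refl = ≤-trans (fullLoad-move σ j i) fits
    ... | no i′≢i  = ≤-trans (fullLoad-move-≤ σ j i i′ i′≢i) (σ≤ i′)

  -- `retry` may turn `bb` into `bl` or `ba`, and `bl` into `ba`, but never the reverse; hence the
  -- first component. When the least big job leaves, its successor has a larger key, so fewer jobs
  -- lie above it and the second component of `bl` falls.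
  digit : Blocker → ℕ × ℕ
  digit (sa _ _ v) = 0 , v
  digit (ba _ _ v) = 0 , v
  digit (bl _ _ k) = 1 , ∑∣ (λ _ → 1) (λ x → key k <? key x)
  digit (bb _ _ v) = 2 , v

  -- Validity of a stack and its invariance under moves

  module Insertion (new : Fin n) (Kept : Fin n → Set) where

    Activates : Partial → Blocker → Fin n → Set
    Activates σ (sa _ i _) j = On σ i j
    Activates σ (ba _ i _) j = On σ i j
    Activates σ (bb _ i _) j = BigOn σ i j
    Activates σ (bl _ _ k) j = j ≡ k

    Active : Partial → List Blocker → Fin n → Set
    Active σ []       j = j ≡ new
    Active σ (B ∷ Bs) j = Activates σ B j ⊎ Active σ Bs j

    activates? : ∀ σ B → Decidable (Activates σ B)
    activates? σ (sa _ i _) j = on? σ i j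
    activates? σ (ba _ i _) j = on? σ i j
    activates? σ (bb _ i _) j = bigOn? σ i j
    activates? σ (bl _ _ k) j = j ≟ k

    active? : ∀ σ Bs → Decidable (Active σ Bs)
    active? σ []       j = j ≟ new
    active? σ (B ∷ Bs) j = activates? σ B j ⊎-dec active? σ Bs j

    active-new : ∀ σ Bs → Active σ Bs new
    active-new σ []       = refl
    active-new σ (B ∷ Bs) = inj₂ (active-new σ Bs)

    active-on-full : ∀ σ Bs {i j} → On σ i j → Full Bs i → Active σ Bs j
    active-on-full σ (sa _ _ _ ∷ Bs) on (inj₁ refl) = inj₁ on
    active-on-full σ (sa _ _ _ ∷ Bs) on (inj₂ full) = inj₂ (active-on-full σ Bs on full)
    active-on-full σ (ba _ _ _ ∷ Bs) on (inj₁ refl) = inj₁ on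
    active-on-full σ (ba _ _ _ ∷ Bs) on (inj₂ full) = inj₂ (active-on-full σ Bs on full)
    active-on-full σ (bb _ _ _ ∷ Bs) on full        = inj₂ (active-on-full σ Bs on full)
    active-on-full σ (bl _ _ _ ∷ Bs) on full        = inj₂ (active-on-full σ Bs on full)

    -- A big job with key below that of k would become the least big job itself, undoing progress; it is harmless
    -- to refuse it because k already accounts for as much z-value.
    BigOpen : List Blocker → Fin n → Fin m → Set
    BigOpen Bs j i = ¬ BigBlocked Bs i × (∀ k → LeastBlocked Bs i k → key k < key j)

    Permitted : Partial → List Blocker → Fin n → Fin m → Set
    Permitted σ Bs j i = i ∈ Γ j × ¬ On σ i j × ¬ Full Bs i × (Big j → BigOpen Bs j i)

    permitted? : ∀ σ Bs j i → Dec (Permitted σ Bs j i)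
    permitted? σ Bs j i = (i ∈? Γ j) ×-dec ¬? (on? σ i j) ×-dec ¬? (full? Bs i) ×-dec
      ((3 * τ <? w j) →-dec (¬? (bigBlocked? Bs i) ×-dec all? (λ k → leastBlocked? Bs i k →-dec (key k <? key j))))

    permitted-tail : ∀ {σ} B {Bs j i} → Permitted σ (B ∷ Bs) j i → Permitted σ Bs j i
    permitted-tail B (i∈Γj , off , ¬full , open?) = i∈Γj , off , ¬full ∘ full-∷ B ,
      λ big → proj₁ (open? big) ∘ bigBlocked-∷ B , λ k → proj₂ (open? big) k ∘ leastBlocked-∷ B

    -- Small moves take precedence: blockers for big jobs are put only on closed stacks. `bl` and
    -- `bb` record this too, because `retry` may turn them into `ba`, and `#ba≤#sa` relies on it
    -- there.
    Closed : Partial → List Blocker → Set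
    Closed σ Bs = ∀ j → Small j → j ≡ new ⊎ (∃ λ i → On σ i j × Full Bs i) → ∀ i → i ∈ Γ j → Full Bs i

    -- For a big j the inequalities say who is in the way if the stuck jobs stay. `ba`: all big jobs
    -- could stay, so other small ones are. `bl`: even the least big job is. `bb`: some big job
    -- could stay, but not all of them.
    Blocks : Partial → List Blocker → Blocker → Set
    Blocks σ Bs (sa j i v) = Small j × 11 * τ < fullLoad σ i + w j × count σ i ≤ v
    Blocks σ Bs (ba j i v) = Big j × Closed σ Bs × stuckLoad σ Bs i + bigLoad σ i + w j ≤ 11 * τ ×
      11 * τ < fullLoad σ i + w j × count σ i ≤ v
    Blocks σ Bs (bl j i k) = Big j × Closed σ Bs × stuckLoad σ Bs i + w j ≤ 11 * τ ×
      11 * τ < stuckLoad σ Bs i + w k + w j × LeastBig σ i k × (∀ k′ → ¬ LeastBlocked Bs i k′)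
    Blocks σ Bs (bb j i v) = Big j × Closed σ Bs ×
      (∃ λ k → BigOn σ i k × stuckLoad σ Bs i + w k + w j ≤ 11 * τ) ×
      11 * τ < stuckLoad σ Bs i + bigLoad σ i + w j × bigCount σ i ≤ v

    -- Every level refers to the same current schedule but sees only the older blockers, so the
    -- newer part of a stack can be discarded at any time.
    Valid : Partial → List Blocker → Set
    Valid σ []       = ⊤
    Valid σ (B ∷ Bs) = Valid σ Bs × Permitted σ Bs (job B) (mach B) × Active σ Bs (job B) × Blocks σ Bs B

    State : Partial → Set
    State σ = Feasible σ × (∀ i → ¬ On σ i new) × (∀ j → Kept j → ∃ λ i → On σ i j)

    module Relocation {σ : Partial} {j : Fin n} {i₀ i : Fin m} (st : State σ) (at : On σ i₀ j)
                      (i∈Γj : i ∈ Γ j) (off : ¬ On σ i j) where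

      σ′ : Partial
      σ′ = move σ j i

      i≢i₀ : i ≢ i₀
      i≢i₀ refl = off at

      module _ {Bs : List Blocker} (¬active : ¬ Active σ Bs j) (¬full : ¬ Full Bs i) where

        stuck-⇒ : ∀ i₁ x → Stuck σ Bs i₁ x → Stuck σ′ Bs i₁ x
        stuck-⇒ i₁ x (small , on , ⊆F) with x ≟ j
        ... | no x≢j = small , trans (move-away σ j i x≢j) on , ⊆F
        ... | yes refl with ⊆F i i∈Γj
        ...   | inj₁ refl = contradiction on off
        ...   | inj₂ full = contradiction full ¬full

        stuck-⇐ : ∀ i₁ x → Stuck σ′ Bs i₁ x → Stuck σ Bs i₁ x
        stuck-⇐ i₁ x (small , on , ⊆F) with x ≟ j
        ... | no x≢j = small , trans (sym (move-away σ j i x≢j)) on , ⊆F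
        ... | yes refl with ⊆F i₀ (proj₁ (proj₁ st) j i₀ at) | just-injective (trans (sym (move-at σ j i)) on)
        ...   | inj₁ refl | i≡i₁ = contradiction i≡i₁ i≢i₀
        ...   | inj₂ full | _    = contradiction (active-on-full σ Bs at full) ¬active

        -- The moving job is stuck neither before nor after: before, its target would have to be
        -- full; after, its old machine would, which would make the job active.
        stuckLoad-≡ : ∀ i₁ → stuckLoad σ′ Bs i₁ ≡ stuckLoad σ Bs i₁
        stuckLoad-≡ i₁ = ∑∣-cong w (stuck? σ′ Bs i₁) (stuck? σ Bs i₁) (stuck-⇐ i₁) (stuck-⇒ i₁)

        closed-pres : Closed σ Bs → Closed σ′ Bs
        closed-pres closed x small (inj₁ refl) = closed x small (inj₁ refl)
        closed-pres closed x small (inj₂ (i₁ , on , full)) with i₁ ≟ i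
        ... | yes refl = contradiction full ¬full
        ... | no i₁≢i  = closed x small (inj₂ (i₁ , proj₁ (moved-on σ j i i₁ i₁≢i x on) , full))

      active-pres : ∀ {Bs} → ¬ Active σ Bs j → ∀ x → Active σ Bs x → Active σ′ Bs x
      active-pres {Bs} ¬active x active = go Bs (λ { refl → ¬active active }) active
        where
        activates-pres : ∀ B → x ≢ j → Activates σ B x → Activates σ′ B x
        activates-pres (sa _ _ _) x≢j on       = trans (move-away σ j i x≢j) on
        activates-pres (ba _ _ _) x≢j on       = trans (move-away σ j i x≢j) on
        activates-pres (bb _ _ _) x≢j (b , on) = b , trans (move-away σ j i x≢j) on
        activates-pres (bl _ _ _) x≢j eq       = eq
        go : ∀ Bs → x ≢ j → Active σ Bs x → Active σ′ Bs x
        go []       x≢j eq         = eq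
        go (B ∷ Bs) x≢j (inj₁ act) = inj₁ (activates-pres B x≢j act)
        go (B ∷ Bs) x≢j (inj₂ act) = inj₂ (go Bs x≢j act)

      permitted-pres : ∀ {Bs x i₁} → x ≢ j → Permitted σ Bs x i₁ → Permitted σ′ Bs x i₁
      permitted-pres x≢j (i∈ , away , rest) = i∈ , away ∘ trans (sym (move-away σ j i x≢j)) , rest

      module _ (i₁ : Fin m) (¬on : ¬ On σ i₁ j) (i₁≢i : i₁ ≢ i) where

        on-⇒ : ∀ x → On σ i₁ x → On σ′ i₁ x
        on-⇒ x on = trans (move-away σ j i (λ { refl → ¬on on })) on

        on-⇐ : ∀ x → On σ′ i₁ x → On σ i₁ x
        on-⇐ x = proj₁ ∘ moved-on σ j i i₁ i₁≢i x

        fullLoad-≡ : fullLoad σ′ i₁ ≡ fullLoad σ i₁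
        fullLoad-≡ = ∑∣-cong w (on? σ′ i₁) (on? σ i₁) on-⇐ on-⇒

        count-≡ : count σ′ i₁ ≡ count σ i₁
        count-≡ = ∑∣-cong (λ _ → 1) (on? σ′ i₁) (on? σ i₁) on-⇐ on-⇒

      module _ (i₁ : Fin m) (¬bigOn : ¬ BigOn σ i₁ j) (stays : Big j → i₁ ≢ i) where

        big-⇒ : ∀ x → BigOn σ i₁ x → BigOn σ′ i₁ x
        big-⇒ x (b , on) = b , trans (move-away σ j i (λ { refl → ¬bigOn (b , on) })) on

        big-⇐ : ∀ x → BigOn σ′ i₁ x → BigOn σ i₁ x
        big-⇐ x (b , on) with x ≟ j
        ... | yes refl = contradiction (just-injective (trans (sym on) (move-at σ j i))) (stays b)
        ... | no x≢j   = b , trans (sym (move-away σ j i x≢j)) on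

        bigLoad-≡ : bigLoad σ′ i₁ ≡ bigLoad σ i₁
        bigLoad-≡ = ∑∣-cong w (bigOn? σ′ i₁) (bigOn? σ i₁) big-⇐ big-⇒

        bigCount-≡ : bigCount σ′ i₁ ≡ bigCount σ i₁
        bigCount-≡ = ∑∣-cong (λ _ → 1) (bigOn? σ′ i₁) (bigOn? σ i₁) big-⇐ big-⇒

      -- Inactivity of j excludes the harmful departures, permission the harmful arrivals: a full
      -- machine receives nothing, a `bb` machine no big job, and a `bl` machine only big jobs with
      -- key above the recorded one. Small jobs may come and go on the last two, since only big and
      -- stuck jobs count there.
      blocks-pres : ∀ B {Bs} → ¬ Active σ (B ∷ Bs) j → Permitted σ (B ∷ Bs) j i → Blocks σ Bs B → Blocks σ′ Bs B
      blocks-pres (sa _ i₁ _) ¬act (_ , _ , ¬full , _) (small , over , cnt)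
        rewrite fullLoad-≡ i₁ (¬act ∘ inj₁) (¬full ∘ inj₁ ∘ sym) | count-≡ i₁ (¬act ∘ inj₁) (¬full ∘ inj₁ ∘ sym) =
        small , over , cnt
      blocks-pres (ba _ i₁ _) {Bs} ¬act (_ , _ , ¬full , _) (big , closed , core , over , cnt)
        rewrite fullLoad-≡ i₁ (¬act ∘ inj₁) (¬full ∘ inj₁ ∘ sym) | count-≡ i₁ (¬act ∘ inj₁) (¬full ∘ inj₁ ∘ sym)
              | stuckLoad-≡ {Bs} (¬act ∘ inj₂) (¬full ∘ inj₂) i₁
              | bigLoad-≡ i₁ (¬act ∘ inj₁ ∘ proj₂) (λ _ → ¬full ∘ inj₁ ∘ sym) =
        big , closed-pres {Bs} (¬act ∘ inj₂) (¬full ∘ inj₂) closed , core , over , cnt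
      blocks-pres (bb _ i₁ _) {Bs} ¬act (_ , _ , ¬full , op) (big , closed , (k , kbig , kfits) , over , cnt)
        rewrite stuckLoad-≡ {Bs} (¬act ∘ inj₂) ¬full i₁
              | bigLoad-≡ i₁ (¬act ∘ inj₁) (λ b eq → proj₁ (op b) (inj₁ (sym eq)))
              | bigCount-≡ i₁ (¬act ∘ inj₁) (λ b eq → proj₁ (op b) (inj₁ (sym eq))) =
        big , closed-pres {Bs} (¬act ∘ inj₂) ¬full closed ,
        (k , big-⇒ i₁ (¬act ∘ inj₁) (λ b eq → proj₁ (op b) (inj₁ (sym eq))) k kbig , kfits) , over , cnt
      blocks-pres (bl _ i₁ k) {Bs} ¬act (_ , _ , ¬full , op) (big , closed , fits , over , ((kb , kon) , least) , fresh)
        rewrite stuckLoad-≡ {Bs} (¬act ∘ inj₂) ¬full i₁ =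
        big , closed-pres {Bs} (¬act ∘ inj₂) ¬full closed , fits , over ,
        ((kb , trans (move-away σ j i (λ { refl → ¬act (inj₁ refl) })) kon) , least′) , fresh
        where
        least′ : ∀ k′ → BigOn σ′ i₁ k′ → key k ≤ key k′
        least′ k′ (b , on) with k′ ≟ j
        ... | no k′≢j  = least k′ (b , trans (sym (move-away σ j i k′≢j)) on)
        ... | yes refl = <⇒≤ (proj₂ (op b) k (inj₁ (just-injective (trans (sym (move-at σ j i)) on) , refl)))

      valid-pres : ∀ Bs → ¬ Active σ Bs j → Permitted σ Bs j i → Valid σ Bs → Valid σ′ Bs
      valid-pres []       ¬act perm v = tt
      valid-pres (B ∷ Bs) ¬act perm (v , permB , actB , blocks) =
        valid-pres Bs (¬act ∘ inj₂) (permitted-tail {σ} B perm) v ,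
        permitted-pres {Bs} (λ { refl → ¬act (inj₂ actB) }) permB ,
        active-pres {Bs} (¬act ∘ inj₂) (job B) actB ,
        blocks-pres B ¬act perm blocks

    -- Classifying and executing moves

    Success : Set
    Success = ∃ λ σ → Feasible σ × (∀ j → Kept j ⊎ j ≡ new → ∃ λ i → On σ i j)

    _≺_ : ℕ × ℕ → ℕ × ℕ → Set
    _≺_ = ×-Lex _≡_ _<_ _<_

    -- Some blocker of the list can be replaced by one of lower digit, at the price of discarding all later ones.
    Improvement : List Blocker → Set
    Improvement []       = ⊥
    Improvement (B ∷ Bs) =
      (∃ λ σ → ∃ λ B′ → State σ × Valid σ (B′ ∷ Bs) × digit B′ ≺ digit B) ⊎ Improvement Bs

    leastBlocked-valid : ∀ {σ} Bs {i k} → Valid σ Bs → LeastBlocked Bs i k → LeastBig σ i k × Active σ Bs k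
    leastBlocked-valid (sa _ _ _ ∷ Bs) (v , _) lb = map₂ inj₂ (leastBlocked-valid Bs v lb)
    leastBlocked-valid (ba _ _ _ ∷ Bs) (v , _) lb = map₂ inj₂ (leastBlocked-valid Bs v lb)
    leastBlocked-valid (bb _ _ _ ∷ Bs) (v , _) lb = map₂ inj₂ (leastBlocked-valid Bs v lb)
    leastBlocked-valid (bl _ _ _ ∷ Bs) (v , _) (inj₂ lb) = map₂ inj₂ (leastBlocked-valid Bs v lb)
    leastBlocked-valid (bl _ _ _ ∷ Bs) (_ , _ , _ , _ , _ , _ , _ , least , _) (inj₁ (refl , refl)) = least , inj₁ refl

    ≺-wellFounded : WellFounded _≺_
    ≺-wellFounded = ×-wellFounded <-wellFounded <-wellFounded

    -- For a small job permission makes no demand on big jobs, so a machine in `Γ j` that is neither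
    -- full nor its current one would be a permitted move. Its current machine is full by `origin`.
    smallClosed : ∀ {σ Bs} → (∀ i → ¬ On σ i new) →
                  ¬ (∃ λ j → ∃ λ i → Small j × Active σ Bs j × Permitted σ Bs j i) → Closed σ Bs
    smallClosed {σ} {Bs} unassigned ∄ j small origin i i∈Γj with full? Bs i | on? σ i j
    ... | yes full | _ = full
    ... | no ¬full | no off = contradiction
      (j , i , small , active origin , i∈Γj , off , ¬full , λ big → contradiction small (<⇒≱ big)) ∄
      where
      active : j ≡ new ⊎ (∃ λ i → On σ i j × Full Bs i) → Active σ Bs j
      active (inj₁ refl)            = active-new σ Bs
      active (inj₂ (_ , on , full)) = active-on-full σ Bs on full
    ... | no ¬full | yes on = stays origin
      where
      stays : j ≡ new ⊎ (∃ λ i → On σ i j × Full Bs i) → Full Bs i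
      stays (inj₁ refl) = contradiction on (unassigned i)
      stays (inj₂ (_ , on′ , full)) = subst (Full Bs) (just-injective (trans (sym on′) on)) full

    data Outcome (σ : Partial) (Bs : List Blocker) (j : Fin n) (i : Fin m) : Set where
      fits    : fullLoad σ i + w j ≤ 11 * τ → Outcome σ Bs j i
      all     : Valid σ (ba j i (count σ i) ∷ Bs) → Outcome σ Bs j i
      least   : ∀ k → Valid σ (bl j i k ∷ Bs) → Outcome σ Bs j i
      bigOnes : ∀ k → LeastBig σ i k → stuckLoad σ Bs i + w k + w j ≤ 11 * τ →
                Valid σ (bb j i (bigCount σ i) ∷ Bs) → Outcome σ Bs j i

    -- If the stuck jobs leave no room, no blocker can help; if they leave none together with a
    -- recorded least job k, an existing `bl` already activates k. Failure of either clause is what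
    -- `Blocked` records.
    Promising : Partial → List Blocker → Fin n → Fin m → Set
    Promising σ Bs j i = stuckLoad σ Bs i + w j ≤ 11 * τ ×
      (∀ k → LeastBlocked Bs i k → stuckLoad σ Bs i + w k + w j ≤ 11 * τ)

    promising? : ∀ σ Bs j i → Dec (Promising σ Bs j i)
    promising? σ Bs j i = (_ ≤? _) ×-dec all? (λ k → leastBlocked? Bs i k →-dec (_ ≤? _))

    classify : ∀ {σ} Bs {j i} → Valid σ Bs → Closed σ Bs → Big j → Active σ Bs j → Permitted σ Bs j i →
               Promising σ Bs j i → Outcome σ Bs j i
    classify {σ} Bs {j} {i} v closed big act perm (stuckFits , leastFits)
      with fullLoad σ i + w j ≤? 11 * τ | stuckLoad σ Bs i + bigLoad σ i + w j ≤? 11 * τ | argmin key (bigOn? σ i)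
    ... | yes p | _      | _ = fits p
    ... | no ¬p | yes q  | _ = all (v , perm , act , big , closed , q , ≰⇒> ¬p , ≤-refl)
    ... | no _  | no ¬q  | inj₁ none = contradiction
      (subst (λ b → stuckLoad σ Bs i + b + w j ≤ 11 * τ) (sym (∑∣-none w (bigOn? σ i) none))
        (subst (λ s → s + w j ≤ 11 * τ) (sym (+-identityʳ _)) stuckFits)) ¬q
    ... | no _  | no ¬q  | inj₂ (k , bigOn , k≤) with stuckLoad σ Bs i + w k + w j ≤? 11 * τ
    ...   | yes r = bigOnes k (bigOn , k≤) r (v , perm , act , big , closed , (k , bigOn , r) , ≰⇒> ¬q , ≤-refl)
    ...   | no ¬r = least k (v , perm , act , big , closed , stuckFits , ≰⇒> ¬r , (bigOn , k≤) , fresh)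
      where
      -- A recorded k′ is still a big job on i, hence no smaller than k, and `leastFits` makes room
      -- even beside k′.
      fresh : ∀ k′ → ¬ LeastBlocked Bs i k′
      fresh k′ lb = ¬r (≤-trans (+-monoˡ-≤ (w j) (+-monoʳ-≤ (stuckLoad σ Bs i)
        (key-≤⇒w-≤ (k≤ k′ (proj₁ (proj₁ (leastBlocked-valid Bs v lb))))))) (leastFits k′ lb))

    activates-on : ∀ {σ} B {Bs j} → Valid σ (B ∷ Bs) → Activates σ B j → On σ (mach B) j
    activates-on (sa _ _ _) _ on       = on
    activates-on (ba _ _ _) _ on       = on
    activates-on (bb _ _ _) _ (_ , on) = on
    activates-on (bl _ _ _) (_ , _ , _ , _ , _ , _ , _ , ((_ , on) , _) , _) refl = on

    module _ {σ : Partial} {j : Fin n} {i : Fin m} (st : State σ) (i∈Γj : i ∈ Γ j) (off : ¬ On σ i j)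
             (room : fullLoad σ i + w j ≤ 11 * τ) where

      state-move : ∀ {i₀} → On σ i₀ j → State (move σ j i)
      state-move {i₀} at = feasible-move (proj₁ st) i∈Γj room , new′ , kept′
        where
        new′ : ∀ i′ → ¬ On (move σ j i) i′ new
        new′ i′ on = proj₁ (proj₂ st) i′ (trans (sym (move-away σ j i (λ { refl → proj₁ (proj₂ st) i₀ at }))) on)
        kept′ : ∀ x → Kept x → ∃ λ i′ → On (move σ j i) i′ x
        kept′ x kx with x ≟ j
        ... | yes refl = i , move-at σ j i
        ... | no x≢j   = map₂ (trans (move-away σ j i x≢j)) (proj₂ (proj₂ st) x kx)

      module Retry (B : Blocker) (Bs : List Blocker) (v : Valid σ (B ∷ Bs)) (acts : Activates σ B j)
                   (¬act : ¬ Active σ Bs j) (perm : Permitted σ (B ∷ Bs) j i) where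

        σ′ : Partial
        σ′ = move σ j i

        vBs : Valid σ Bs
        vBs = proj₁ v

        at : On σ (mach B) j
        at = activates-on B v acts

        open Relocation st at i∈Γj off hiding (σ′)

        permBs : Permitted σ Bs j i
        permBs = permitted-tail {σ} B perm

        ¬full : ¬ Full Bs i
        ¬full = proj₁ (proj₂ (proj₂ permBs))

        vBs′ : Valid σ′ Bs
        vBs′ = valid-pres Bs ¬act permBs vBs

        permB′ : Permitted σ′ Bs (job B) (mach B)
        permB′ = permitted-pres {Bs} (λ { refl → ¬act (proj₁ (proj₂ (proj₂ v))) }) (proj₁ (proj₂ v))

        actB′ : Active σ′ Bs (job B)
        actB′ = active-pres {Bs} ¬act (job B) (proj₁ (proj₂ (proj₂ v)))

        left : ∀ x → On σ′ (mach B) x → On σ (mach B) x × x ≢ j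
        left = moved-on σ j i (mach B) (i≢i₀ ∘ sym)

        count-< : count σ′ (mach B) < count σ (mach B)
        count-< = ∑∣-mono-< (λ _ → 1) (on? σ′ (mach B)) (on? σ (mach B)) (λ x → proj₁ ∘ left x) j
          (λ on → proj₂ (left j on) refl) at (s≤s z≤n)

        stuck≡ : stuckLoad σ′ Bs (mach B) ≡ stuckLoad σ Bs (mach B)
        stuck≡ = stuckLoad-≡ {Bs} ¬act ¬full (mach B)

        bigLeft : ∀ x → BigOn σ′ (mach B) x → BigOn σ (mach B) x
        bigLeft x (b , on) = b , proj₁ (left x on)

        closed′ : Closed σ Bs → Closed σ′ Bs
        closed′ = closed-pres {Bs} ¬act ¬full

      -- The departed job was activated by B alone, so the older blockers are unaffected. For `sa`
      -- and `ba` one job fewer remains on the machine; for `bl` and `bb` the waiting move is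
      -- classified afresh.
      retry : ∀ B Bs → Valid σ (B ∷ Bs) → Activates σ B j → ¬ Active σ Bs j → Permitted σ (B ∷ Bs) j i →
              fullLoad (move σ j i) (mach B) + w (job B) ≤ 11 * τ ⊎
              ∃ λ B′ → Valid (move σ j i) (B′ ∷ Bs) × digit B′ ≺ digit B
      retry B@(sa j₁ i₁ _) Bs v@(_ , _ , _ , small , _ , cnt) acts ¬act perm =
        decide (fullLoad (move σ j i) i₁ + w j₁ ≤? 11 * τ)
        where
        open Retry B Bs v acts ¬act perm
        decide : Dec (fullLoad σ′ i₁ + w j₁ ≤ 11 * τ) → _
        decide (yes p) = inj₁ p
        decide (no ¬p) = inj₂ (sa j₁ i₁ (count σ′ i₁) , (vBs′ , permB′ , actB′ , small , ≰⇒> ¬p , ≤-refl) ,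
                               inj₂ (refl , <-≤-trans count-< cnt))
      retry B@(ba j₁ i₁ _) Bs v@(_ , _ , _ , big , closed , core , _ , cnt) acts ¬act perm =
        decide (fullLoad (move σ j i) i₁ + w j₁ ≤? 11 * τ)
        where
        open Retry B Bs v acts ¬act perm
        core′ : stuckLoad σ′ Bs i₁ + bigLoad σ′ i₁ + w j₁ ≤ 11 * τ
        core′ = ≤-trans (+-monoˡ-≤ (w j₁)
          (+-mono-≤ (≤-reflexive stuck≡) (∑∣-mono w (bigOn? σ′ i₁) (bigOn? σ i₁) bigLeft))) core
        decide : Dec (fullLoad σ′ i₁ + w j₁ ≤ 11 * τ) → _
        decide (yes p) = inj₁ p
        decide (no ¬p) = inj₂ (ba j₁ i₁ (count σ′ i₁) ,
                               (vBs′ , permB′ , actB′ , big , closed′ closed , core′ , ≰⇒> ¬p , ≤-refl) ,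
                               inj₂ (refl , <-≤-trans count-< cnt))
      retry B@(bl j₁ i₁ k) Bs v@(_ , _ , _ , big , closed , stuckFits , over , (_ , k≤) , fresh) refl ¬act perm =
        decide (classify Bs vBs′ (closed′ closed) big actB′ permB′ (stuckFits′ , λ k′ lb → contradiction lb (fresh k′)))
        where
        open Retry B Bs v refl ¬act perm
        stuckFits′ : stuckLoad σ′ Bs i₁ + w j₁ ≤ 11 * τ
        stuckFits′ = subst (λ s → s + w j₁ ≤ 11 * τ) (sym stuck≡) stuckFits
        decide : Outcome σ′ Bs j₁ i₁ → _
        decide (fits p) = inj₁ p
        decide (all v′) = inj₂ (ba j₁ i₁ (count σ′ i₁) , v′ , inj₁ (s≤s z≤n))
        decide (least k′ v′@(_ , _ , _ , _ , _ , _ , _ , ((b , on) , _) , _)) = inj₂ (bl j₁ i₁ k′ , v′ , inj₂ (refl ,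
          ∑∣-mono-< (λ _ → 1) (λ x → key k′ <? key x) (λ x → key k <? key x) (λ x → <-trans k<k′) k′
            (<-irrefl refl) k<k′ (s≤s z≤n)))
          where
          k<k′ : key k < key k′
          k<k′ = ≤∧≢⇒< (k≤ k′ (bigLeft k′ (b , on))) (λ eq → proj₂ (left k′ on) (sym (key-injective eq)))
        -- All big jobs still present were there before, so k′ is at least as large as k, and
        -- already k did not fit.
        decide (bigOnes k′ (bigOn , _) r _) = contradiction over (≤⇒≯ (≤-trans
          (+-monoˡ-≤ (w j₁) (+-mono-≤ (≤-reflexive (sym stuck≡)) (key-≤⇒w-≤ (k≤ k′ (bigLeft k′ bigOn))))) r))
      retry B@(bb j₁ i₁ _) Bs v@(_ , _ , _ , big , closed , (k , kOn , kFits) , _ , cnt) acts ¬act perm =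
        decide (classify Bs vBs′ (closed′ closed) big actB′ permB′ (stuckFits′ , leastFits))
        where
        open Retry B Bs v acts ¬act perm
        stuckFits′ : stuckLoad σ′ Bs i₁ + w j₁ ≤ 11 * τ
        stuckFits′ = ≤-trans (+-monoˡ-≤ (w j₁) (≤-trans (≤-reflexive stuck≡) (m≤m+n _ (w k)))) kFits
        leastFits : ∀ k′ → LeastBlocked Bs i₁ k′ → stuckLoad σ′ Bs i₁ + w k′ + w j₁ ≤ 11 * τ
        leastFits k′ lb = ≤-trans (+-monoˡ-≤ (w j₁) (+-mono-≤ (≤-reflexive stuck≡)
          (key-≤⇒w-≤ (proj₂ (proj₁ (leastBlocked-valid Bs vBs lb)) k kOn)))) kFits
        decide : Outcome σ′ Bs j₁ i₁ → _
        decide (fits p) = inj₁ p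
        decide (all v′) = inj₂ (ba j₁ i₁ (count σ′ i₁) , v′ , inj₁ (s≤s z≤n))
        decide (least k′ v′) = inj₂ (bl j₁ i₁ k′ , v′ , inj₁ (s≤s (s≤s z≤n)))
        decide (bigOnes k′ _ _ v′) = inj₂ (bb j₁ i₁ (bigCount σ′ i₁) , v′ , inj₂ (refl , <-≤-trans
          (∑∣-mono-< (λ _ → 1) (bigOn? σ′ i₁) (bigOn? σ i₁) bigLeft j
            (λ bigOn → proj₂ (left j (proj₂ bigOn)) refl) acts (s≤s z≤n)) cnt))

    -- Newer blockers are dropped until the oldest one that activates j is on top; j is then
    -- inactive in the rest, as `Relocation` requires. If the move frees enough room, the job
    -- waiting in that blocker moves in turn, and the chain may run down to the new job itself.
    execute : ∀ Bs {σ j i} → State σ → Valid σ Bs → Active σ Bs j → Permitted σ Bs j i →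
              fullLoad σ i + w j ≤ 11 * τ → Success ⊎ Improvement Bs
    execute [] {σ} {j} {i} st v refl (i∈Γj , _) room =
      inj₁ (move σ j i , feasible-move (proj₁ st) i∈Γj room , assigned)
      where
      assigned : ∀ x → Kept x ⊎ x ≡ new → ∃ λ i′ → On (move σ j i) i′ x
      assigned x (inj₂ refl) = i , move-at σ j i
      assigned x (inj₁ kx) with x ≟ j
      ... | yes refl = i , move-at σ j i
      ... | no x≢j   = map₂ (trans (move-away σ j i x≢j)) (proj₂ (proj₂ st) x kx)
    execute (B ∷ Bs) {σ} {j} {i} st v@(vBs , permB , actB , _) act perm@(i∈Γj , off , _) room with active? σ Bs j
    ... | yes actBs = Sum.map₂ inj₂ (execute Bs st vBs actBs (permitted-tail {σ} B perm) room)
    ... | no ¬act with act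
    ...   | inj₂ actBs = contradiction actBs ¬act
    ...   | inj₁ acts with retry st i∈Γj off room B Bs v acts ¬act perm
    ...     | inj₂ (B′ , v′ , lower) = inj₂ (inj₁
      (move σ j i , B′ , state-move st i∈Γj off room (activates-on B v acts) , v′ , lower))
    ...     | inj₁ room′ = Sum.map₂ inj₂ (execute Bs (state-move st i∈Γj off room at)
      (valid-pres Bs ¬act (permitted-tail {σ} B perm) vBs)
      (active-pres {Bs} ¬act (job B) actB)
      (permitted-pres {Bs} (λ { refl → ¬act actB }) permB) room′)
      where
      at : On σ (mach B) j
      at = activates-on B v acts
      open Relocation st at i∈Γj off

    -- Termination of the search

    Blocked : Partial → List Blocker → Fin n → Fin m → Set
    Blocked σ Bs j i = 11 * τ < stuckLoad σ Bs i + w j ⊎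
      ∃ λ k → LeastBlocked Bs i k × 11 * τ < stuckLoad σ Bs i + w k + w j

    Terminal : Partial → List Blocker → Set
    Terminal σ Bs = Closed σ Bs × (∀ j i → Big j → Active σ Bs j → Permitted σ Bs j i → Blocked σ Bs j i)

    -- A machine can be claimed once as full, once by `bb` and once by `bl`, so a valid stack holds
    -- at most 3m blockers.
    unfull unbig unleast unused : List Blocker → ℕ
    unfull  Bs = ∑∣ (λ _ → 1) (λ i → ¬? (full? Bs i))
    unbig   Bs = ∑∣ (λ _ → 1) (λ i → ¬? (bigBlocked? Bs i))
    unleast Bs = ∑∣ (λ _ → 1) (λ i → ¬? (any? (leastBlocked? Bs i)))
    unused  Bs = unfull Bs + unbig Bs + unleast Bs

    unfull-< : ∀ {i} Bs → ¬ Full Bs i → ∑∣ (λ _ → 1) (λ x → ¬? ((x ≟ i) ⊎-dec full? Bs x)) < unfull Bs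
    unfull-< {i} Bs ¬full = ∑∣-mono-< (λ _ → 1) (λ x → ¬? ((x ≟ i) ⊎-dec full? Bs x)) (λ x → ¬? (full? Bs x))
      (λ x → _∘ inj₂) i (λ ¬f → ¬f (inj₁ refl)) ¬full (s≤s z≤n)

    unused-∷ : ∀ {σ} B Bs → Valid σ (B ∷ Bs) → unused (B ∷ Bs) < unused Bs
    unused-∷ (sa j i _) Bs (_ , (_ , _ , ¬full , _) , _) =
      +-monoˡ-< (unleast Bs) (+-monoˡ-< (unbig Bs) (unfull-< Bs ¬full))
    unused-∷ (ba j i _) Bs (_ , (_ , _ , ¬full , _) , _) =
      +-monoˡ-< (unleast Bs) (+-monoˡ-< (unbig Bs) (unfull-< Bs ¬full))
    unused-∷ (bb j i u) Bs (_ , (_ , _ , _ , op) , _ , big , _) =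
      +-monoˡ-< (unleast Bs) (+-monoʳ-< (unfull Bs) (∑∣-mono-< (λ _ → 1)
        (λ x → ¬? (bigBlocked? (bb j i u ∷ Bs) x)) (λ x → ¬? (bigBlocked? Bs x))
        (λ x → _∘ inj₂) i (λ ¬b → ¬b (inj₁ refl)) (proj₁ (op big)) (s≤s z≤n)))
    unused-∷ (bl j i k) Bs (_ , _ , _ , _ , _ , _ , _ , _ , fresh) =
      +-monoʳ-< (unfull Bs + unbig Bs) (∑∣-mono-< (λ _ → 1)
        (λ x → ¬? (any? (leastBlocked? (bl j i k ∷ Bs) x))) (λ x → ¬? (any? (leastBlocked? Bs x)))
        (λ x → _∘ map₂ inj₂) i (λ ¬l → ¬l (k , inj₁ (refl , refl))) (λ (k′ , lb) → fresh k′ lb) (s≤s z≤n))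

    module _ (¬terminal : ∀ σ Bs → State σ → Valid σ Bs → ¬ Terminal σ Bs) where

      run  : ∀ Bs {σ} → Acc _<_ (unused Bs) → State σ → Valid σ Bs → Success ⊎ Improvement Bs
      push : ∀ Bs → (∀ {u} → u < unused Bs → Acc _<_ u) → ∀ B {σ} → Acc _≺_ (digit B) → State σ → Valid σ (B ∷ Bs) →
             Success ⊎ Improvement Bs

      run Bs {σ} (acc rec) st v
        with any? (λ j → any? (λ i → (w j ≤? 3 * τ) ×-dec active? σ Bs j ×-dec permitted? σ Bs j i))
      ... | yes (j , i , small , act , perm) with fullLoad σ i + w j ≤? 11 * τ
      ...   | yes room = execute Bs st v act perm room
      ...   | no full  = push Bs rec (sa j i (count σ i)) (≺-wellFounded _) st
        (v , perm , act , small , ≰⇒> full , ≤-refl)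
      run Bs {σ} (acc rec) st v | no ∄small
        with any? (λ j → any? (λ i →
          (3 * τ <? w j) ×-dec active? σ Bs j ×-dec permitted? σ Bs j i ×-dec promising? σ Bs j i))
      ... | yes (j , i , big , act , perm , prom) =
        decide (classify Bs v (smallClosed (proj₁ (proj₂ st)) ∄small) big act perm prom)
        where
        decide : Outcome σ Bs j i → Success ⊎ Improvement Bs
        decide (fits room)        = execute Bs st v act perm room
        decide (all v′)           = push Bs rec (ba j i (count σ i)) (≺-wellFounded _) st v′
        decide (least k v′)       = push Bs rec (bl j i k) (≺-wellFounded _) st v′
        decide (bigOnes _ _ _ v′) = push Bs rec (bb j i (bigCount σ i)) (≺-wellFounded _) st v′
      ... | no ∄big = contradiction (smallClosed (proj₁ (proj₂ st)) ∄small , blocked) (¬terminal σ Bs st v)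
        where
        blocked : ∀ j i → Big j → Active σ Bs j → Permitted σ Bs j i → Blocked σ Bs j i
        blocked j i big act perm with stuckLoad σ Bs i + w j ≤? 11 * τ
          | any? (λ k → leastBlocked? Bs i k ×-dec (11 * τ <? stuckLoad σ Bs i + w k + w j))
        ... | no ¬p | _ = inj₁ (≰⇒> ¬p)
        ... | yes _ | yes lb = inj₂ lb
        ... | yes p | no ∄lb = contradiction
          (j , i , big , act , perm , p , λ k lb → ≮⇒≥ (λ over → ∄lb (k , lb , over))) ∄big

      push Bs rec B {σ} (acc lower) st v with run (B ∷ Bs) (rec (unused-∷ {σ} B Bs v)) st v
      ... | inj₁ success                            = inj₁ success
      ... | inj₂ (inj₁ (σ′ , B′ , st′ , v′ , B′≺B)) = push Bs rec B′ (lower B′≺B) st′ v′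
      ... | inj₂ (inj₂ improvement)                 = inj₂ improvement

    -- What valid stacks imply about active jobs

    TwoBig : Partial → List Blocker → Fin m → Set
    TwoBig σ Bs i = ∃ λ k → ∃ λ k′ → k ≢ k′ × (BigOn σ i k × Active σ Bs k) × (BigOn σ i k′ × Active σ Bs k′)

    twoBig-∷ : ∀ {σ} B {Bs i} → TwoBig σ Bs i → TwoBig σ (B ∷ Bs) i
    twoBig-∷ B (k , k′ , k≢k′ , (b , a) , (b′ , a′)) = k , k′ , k≢k′ , (b , inj₂ a) , (b′ , inj₂ a′)

    -- A `bb` blocker has a witness k beside which the waiting job fits, although it does not fit
    -- beside all big jobs; so there is a second big job.
    bigBlocked-valid : ∀ {σ} Bs {i} → Valid σ Bs → BigBlocked Bs i → TwoBig σ Bs i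
    bigBlocked-valid {σ} (B@(sa _ _ _) ∷ Bs) (v , _) blocked        = twoBig-∷ {σ} B (bigBlocked-valid Bs v blocked)
    bigBlocked-valid {σ} (B@(ba _ _ _) ∷ Bs) (v , _) blocked        = twoBig-∷ {σ} B (bigBlocked-valid Bs v blocked)
    bigBlocked-valid {σ} (B@(bl _ _ _) ∷ Bs) (v , _) blocked        = twoBig-∷ {σ} B (bigBlocked-valid Bs v blocked)
    bigBlocked-valid {σ} (B@(bb _ _ _) ∷ Bs) (v , _) (inj₂ blocked) = twoBig-∷ {σ} B (bigBlocked-valid Bs v blocked)
    bigBlocked-valid {σ} (bb j i _ ∷ Bs) (_ , _ , _ , _ , _ , (k , kOn , kFits) , over , _) (inj₁ refl)
      with any? (λ k′ → ¬? (k ≟ k′) ×-dec bigOn? σ i k′)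
    ... | yes (k′ , k≢k′ , k′On) = k , k′ , k≢k′ , (kOn , inj₁ kOn) , (k′On , inj₁ k′On)
    ... | no ∄k′ = contradiction over (≤⇒≯ (≤-trans (+-monoˡ-≤ (w j) (+-monoʳ-≤ (stuckLoad σ Bs i) only)) kFits))
      where
      only : bigLoad σ i ≤ w k
      only = ≤-trans (∑-mono pointwise) (≤-reflexive (∑-at (w k) k))
        where
        pointwise : ∀ x → w x when bigOn? σ i x ≤ w k when (x ≟ k)
        pointwise x = when-≤ʳ (bigOn? σ i x) λ on → at on
          where
          at : BigOn σ i x → w x ≤ w k when (x ≟ k)
          at on with x ≟ k
          ... | yes refl = ≤-refl
          ... | no x≢k   = contradiction (x , x≢k ∘ sym , on) ∄k′

    active-small : ∀ {σ} Bs {j} → Valid σ Bs → Active σ Bs j → Small j → j ≡ new ⊎ ∃ λ i → On σ i j × Full Bs i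
    active-small []       _       refl        small = inj₁ refl
    active-small (B ∷ Bs) (v , _) (inj₂ act)  small = Sum.map₂ (map₂ (map₂ (full-∷ B))) (active-small Bs v act small)
    active-small (sa _ i _ ∷ Bs) _ (inj₁ on)  small = inj₂ (i , on , inj₁ refl)
    active-small (ba _ i _ ∷ Bs) _ (inj₁ on)  small = inj₂ (i , on , inj₁ refl)
    active-small (bb _ _ _ ∷ Bs) _ (inj₁ (big , _)) small = contradiction small (<⇒≱ big)
    active-small (bl _ _ _ ∷ Bs) (_ , _ , _ , _ , _ , _ , _ , ((big , _) , _) , _) (inj₁ refl) small =
      contradiction small (<⇒≱ big)

    #sa #ba : List Blocker → ℕ
    #sa []              = 0
    #sa (sa _ _ _ ∷ Bs) = suc (#sa Bs)
    #sa (ba _ _ _ ∷ Bs) = #sa Bs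
    #sa (bb _ _ _ ∷ Bs) = #sa Bs
    #sa (bl _ _ _ ∷ Bs) = #sa Bs
    #ba []              = 0
    #ba (sa _ _ _ ∷ Bs) = #ba Bs
    #ba (ba _ _ _ ∷ Bs) = suc (#ba Bs)
    #ba (bb _ _ _ ∷ Bs) = #ba Bs
    #ba (bl _ _ _ ∷ Bs) = #ba Bs

    -- A ba-blocked machine holds a small job that is not stuck, so the closure under
    -- small jobs that must precede the next ba-blocker adds at least one sa-blocker.
    #ba≤#sa : ∀ {σ} Bs → Valid σ Bs → #ba Bs ≤ suc (#sa Bs) × (Closed σ Bs → #ba Bs ≤ #sa Bs)
    #ba≤#sa []              _       = z≤n , λ _ → z≤n
    #ba≤#sa (sa _ _ _ ∷ Bs) (v , _) = m≤n⇒m≤1+n (proj₁ (#ba≤#sa Bs v)) , λ _ → proj₁ (#ba≤#sa Bs v)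
    #ba≤#sa (bb _ _ _ ∷ Bs) (v , _) = #ba≤#sa Bs v
    #ba≤#sa (bl _ _ _ ∷ Bs) (v , _) = #ba≤#sa Bs v
    #ba≤#sa {σ} (ba j i u ∷ Bs) (v , _ , _ , _ , closed , core , over , _) =
      s≤s (proj₂ (#ba≤#sa Bs v) closed) ,
      λ closed′ → contradiction over (≤⇒≯ (≤-trans (+-monoˡ-≤ (w j) (allCore closed′)) core))
      where
      allCore : Closed σ (ba j i u ∷ Bs) → fullLoad σ i ≤ stuckLoad σ Bs i + bigLoad σ i
      allCore closed′ = ≤-trans (∑-mono pointwise) (≤-reflexive (∑-+ (λ x → w x when stuck? σ Bs i x) _))
        where
        pointwise : ∀ x → w x when on? σ i x ≤ w x when stuck? σ Bs i x + w x when bigOn? σ i x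
        pointwise x = when-≤ʳ (on? σ i x) λ on → covered on (w x ≤? 3 * τ)
          where
          covered : On σ i x → Dec (Small x) → w x ≤ w x when stuck? σ Bs i x + w x when bigOn? σ i x
          -- `Full (ba j i u ∷ Bs) i′` unfolds to `i′ ≡ i ⊎ Full Bs i′`, exactly the condition in
          -- `Stuck`.
          covered on (yes small) = ≤-trans (≤-reflexive (sym (when-yes (stuck? σ Bs i x)
                  (small , on , closed′ x small (inj₂ (i , on , inj₁ refl)))))) (m≤m+n _ _)
          covered on (no ¬small) = ≤-trans (≤-reflexive (sym (when-yes (bigOn? σ i x) (≰⇒> ¬small , on)))) (m≤n+m _ _)

    -- Capping at 5τ loses at most τ per job, and two capped jobs already contribute 10τ.
    capped-sum : ∀ {k} (f g : Fin k → ℕ) → (∀ x → f x ≤ g x ⊎ (f x ≤ g x + τ × 5 * τ ≤ g x)) →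
                 ∑ f ≤ ∑ g ⊎ (∑ f ≤ ∑ g + τ × 5 * τ ≤ ∑ g) ⊎ 10 * τ ≤ ∑ g
    capped-sum {zero}  f g h = inj₁ z≤n
    capped-sum {suc k} f g h with h zero | capped-sum (f ∘ suc) (g ∘ suc) (h ∘ suc)
    ... | inj₁ p       | inj₁ q              = inj₁ (+-mono-≤ p q)
    ... | inj₁ p       | inj₂ (inj₁ (q , r)) = inj₂ (inj₁
          (≤-trans (+-mono-≤ p q) (≤-reflexive (sym (+-assoc (g zero) _ τ))) , ≤-trans r (m≤n+m _ (g zero))))
    ... | inj₁ p       | inj₂ (inj₂ q)       = inj₂ (inj₂ (≤-trans q (m≤n+m _ (g zero))))
    ... | inj₂ (p , r) | inj₁ q              = inj₂ (inj₁
          (≤-trans (+-mono-≤ p q) (≤-reflexive (swap (g zero) τ _)) , ≤-trans r (m≤m+n (g zero) _)))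
      where
      swap : ∀ a b c → a + b + c ≡ a + c + b
      swap = solve-∀
    ... | inj₂ (_ , r) | inj₂ (inj₁ (_ , r′)) = inj₂ (inj₂ (≤-trans (≤-reflexive (double τ)) (+-mono-≤ r r′)))
      where
      double : ∀ t → 10 * t ≡ 5 * t + 5 * t
      double = solve-∀
    ... | inj₂ _       | inj₂ (inj₂ q)       = inj₂ (inj₂ (≤-trans q (m≤n+m _ (g zero))))

    -- The violated dual at a terminal state

    module Dual (dual : (z : Fin n → ℕ) (y : Fin m → ℕ) →
                   (∀ i (C : Subset n) → (∀ j → j ∈ C → i ∈ Γ j) → ∑∣ w (_∈? C) ≤ 6 * τ → ∑∣ z (_∈? C) ≤ y i) →
                   ∑ z ≤ ∑ y)
                (w≤6τ : ∀ j → w j ≤ 6 * τ) (0<new : 0 < w new) where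

      module _ (σ : Partial) (Bs : List Blocker) (st : State σ) (v : Valid σ Bs) (term : Terminal σ Bs) where

        closed : Closed σ Bs
        closed = proj₁ term

        Awake : Fin n → Set
        Awake j = Active σ Bs j ⊎ ∃ λ i → Stuck σ Bs i j

        awake? : Decidable Awake
        awake? j = active? σ Bs j ⊎-dec any? (λ i → stuck? σ Bs i j)

        z : Fin n → ℕ
        z j = (w j ⊓ (5 * τ)) when awake? j

        zLoad : Fin m → ℕ
        zLoad i = ∑∣ z (on? σ i)

        z≤w : ∀ j → z j ≤ w j
        z≤w j = ≤-trans (when-≤ (awake? j)) (m⊓n≤m (w j) _)

        z≤5τ : ∀ j → z j ≤ 5 * τ
        z≤5τ j = ≤-trans (when-≤ (awake? j)) (m⊓n≤n (w j) _)

        z-awake : ∀ {j} → Awake j → z j ≡ w j ⊓ (5 * τ)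
        z-awake {j} = when-yes (awake? j)

        3τ≤5τ : 3 * τ ≤ 5 * τ
        3τ≤5τ = *-monoˡ-≤ τ {3} {5} (s≤s (s≤s (s≤s z≤n)))

        z-stuck : ∀ {i j} → Stuck σ Bs i j → z j ≡ w j
        z-stuck s@(small , _) = trans (z-awake (inj₂ (_ , s))) (m≤n⇒m⊓n≡m (≤-trans small 3τ≤5τ))

        z-big : ∀ {j} → Active σ Bs j → Big j → 3 * τ ≤ z j
        z-big act big = ≤-trans (⊓-glb (<⇒≤ big) 3τ≤5τ) (≤-reflexive (sym (z-awake (inj₁ act))))

        z-mono : ∀ {j k} → Active σ Bs k → w j ≤ w k → z j ≤ z k
        z-mono {j} act wj≤wk = ≤-trans (when-≤ (awake? j))
          (≤-trans (⊓-monoˡ-≤ (5 * τ) wj≤wk) (≤-reflexive (sym (z-awake (inj₁ act)))))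

        -- Closure makes every allowed machine of a small active job full, and a stuck job has no
        -- alternative that is not full.
        awake-off-full : ∀ {i j} → Awake j → i ∈ Γ j → ¬ Full Bs i → Stuck σ Bs i j ⊎ (Active σ Bs j × Big j)
        awake-off-full {i} {j} (inj₁ act) i∈Γj ¬full with w j ≤? 3 * τ
        ... | yes small = contradiction (closed j small (active-small Bs v act small) i i∈Γj) ¬full
        ... | no ¬small = inj₂ (act , ≰⇒> ¬small)
        awake-off-full {i} (inj₂ (i′ , s@(_ , _ , ⊆F))) i∈Γj ¬full with ⊆F i i∈Γj
        ... | inj₁ refl = inj₁ s
        ... | inj₂ full = contradiction full ¬full

        stuck≤zLoad : ∀ i → stuckLoad σ Bs i ≤ zLoad i
        stuck≤zLoad i = ∑-mono λ x → when-≤ʳ (stuck? σ Bs i x) λ s → ≤-reflexive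
          (trans (sym (z-stuck s)) (sym (when-yes (on? σ i x) (proj₁ (proj₂ s)))))

        stuck+big≤zLoad : ∀ {i k} → BigOn σ i k → stuckLoad σ Bs i + z k ≤ zLoad i
        stuck+big≤zLoad {i} {k} (big , on) = begin
          stuckLoad σ Bs i + z k                                     ≡⟨ cong (stuckLoad σ Bs i +_) (∑-at (z k) k) ⟨
          stuckLoad σ Bs i + ∑ (λ x → z k when (x ≟ k))              ≡⟨ ∑-+ (λ x → w x when stuck? σ Bs i x) _ ⟨
          ∑ (λ x → w x when stuck? σ Bs i x + z k when (x ≟ k))      ≤⟨ ∑-mono pointwise ⟩
          zLoad i                                                    ∎
          where
          open ≤-Reasoning
          pointwise : ∀ x → w x when stuck? σ Bs i x + z k when (x ≟ k) ≤ z x when on? σ i x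
          pointwise x with x ≟ k
          ... | yes refl = ≤-reflexive (trans
                  (cong (_+ z x) (when-no (stuck? σ Bs i x) (λ (small , _) → <⇒≱ big small)))
                  (sym (when-yes (on? σ i x) on)))
          ... | no _ = ≤-trans (≤-reflexive (+-identityʳ _)) (when-≤ʳ (stuck? σ Bs i x) λ s → ≤-reflexive
                  (trans (sym (z-stuck s)) (sym (when-yes (on? σ i x) (proj₁ (proj₂ s))))))

        light : ∀ C → ∑∣ w (_∈? C) ≤ 6 * τ → ∑∣ z (_∈? C) ≤ 6 * τ
        light C = ≤-trans (∑-mono λ x → when-≤ʳ (x ∈? C) λ x∈C →
          ≤-trans (z≤w x) (≤-reflexive (sym (when-yes (x ∈? C) x∈C))))

        module _ {i : Fin m} {C : Subset n} (¬full : ¬ Full Bs i) (C⊆Γ : ∀ j → j ∈ C → i ∈ Γ j)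
                 (wC≤6τ : ∑∣ w (_∈? C) ≤ 6 * τ) where

          zC : ℕ
          zC = ∑∣ z (_∈? C)

          -- All awake jobs of C then already lie on i.
          local : ¬ (∃ λ j → j ∈ C × Active σ Bs j × Big j × ¬ On σ i j) → zC ≤ zLoad i
          local ∄j = ∑-mono λ x → when-≤ʳ (x ∈? C) λ x∈C → when-≤ʳ (awake? x) λ awake →
            ≤-reflexive (trans (sym (z-awake awake)) (sym (when-yes (on? σ i x)
              (on x∈C awake (awake-off-full awake (C⊆Γ x x∈C) ¬full)))))
            where
            on : ∀ {x} → x ∈ C → Awake x → Stuck σ Bs i x ⊎ (Active σ Bs x × Big x) → On σ i x
            on x∈C awake (inj₁ (_ , on , _)) = on
            on {x} x∈C awake (inj₂ (act , big)) with on? σ i x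
            ... | yes on = on
            ... | no off = contradiction (x , x∈C , act , big , off) ∄j

          module _ {j : Fin n} (j∈C : j ∈ C) (act : Active σ Bs j) (big : Big j) (off : ¬ On σ i j) where

            -- A second big job would push C above 6τ, so every other awake job of C is stuck on i.
            zC≤stuck+z : zC ≤ stuckLoad σ Bs i + z j
            zC≤stuck+z = begin
              zC                                                        ≤⟨ ∑-mono (λ x → when-≤ʳ (x ∈? C) (pointwise x)) ⟩
              ∑ (λ x → w x when stuck? σ Bs i x + z j when (x ≟ j))     ≡⟨ ∑-+ (λ x → w x when stuck? σ Bs i x) _ ⟩
              stuckLoad σ Bs i + ∑ (λ x → z j when (x ≟ j))             ≡⟨ cong (stuckLoad σ Bs i +_) (∑-at (z j) j) ⟩
              stuckLoad σ Bs i + z j                                    ∎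
              where
              open ≤-Reasoning
              pointwise : ∀ x → x ∈ C → z x ≤ w x when stuck? σ Bs i x + z j when (x ≟ j)
              pointwise x x∈C with x ≟ j
              ... | yes refl = m≤n+m (z x) _
              ... | no x≢j   = ≤-trans (when-≤ʳ (awake? x) λ awake →
                stuck awake (awake-off-full awake (C⊆Γ x x∈C) ¬full)) (m≤m+n _ 0)
                where
                stuck : Awake x → Stuck σ Bs i x ⊎ (Active σ Bs x × Big x) → w x ⊓ (5 * τ) ≤ w x when stuck? σ Bs i x
                stuck _ (inj₁ s) = ≤-trans (m⊓n≤m (w x) _) (≤-reflexive (sym (when-yes (stuck? σ Bs i x) s)))
                stuck _ (inj₂ (_ , bigx)) = contradiction (≤-trans (two-members w (_∈? C) x≢j x∈C j∈C) wC≤6τ)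
                  (<⇒≱ (≤-<-trans (≤-reflexive (halves τ)) (+-mono-< bigx big)))
                  where
                  halves : ∀ t → 6 * t ≡ 3 * t + 3 * t
                  halves = solve-∀

            -- Trading `w j` for `z j` turns the left side into at most w (C) + z j; this is where
            -- the cap 5τ is used.
            zC+w≤11τ : zC + w j ≤ 11 * τ
            zC+w≤11τ = begin
              zC + w j                                             ≡⟨ cong (zC +_) (∑-at (w j) j) ⟨
              zC + ∑ (λ x → w j when (x ≟ j))                      ≡⟨ ∑-+ (λ x → z x when (x ∈? C)) _ ⟨
              ∑ (λ x → z x when (x ∈? C) + w j when (x ≟ j))       ≤⟨ ∑-mono pointwise ⟩
              ∑ (λ x → w x when (x ∈? C) + z j when (x ≟ j))       ≡⟨ ∑-+ (λ x → w x when (x ∈? C)) _ ⟩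
              ∑∣ w (_∈? C) + ∑ (λ x → z j when (x ≟ j))            ≡⟨ cong (∑∣ w (_∈? C) +_) (∑-at (z j) j) ⟩
              ∑∣ w (_∈? C) + z j                                   ≤⟨ +-mono-≤ wC≤6τ (z≤5τ j) ⟩
              6 * τ + 5 * τ                                        ≡⟨ *-distribʳ-+ τ 6 5 ⟨
              11 * τ                                               ∎
              where
              open ≤-Reasoning
              pointwise : ∀ x → z x when (x ∈? C) + w j when (x ≟ j) ≤ w x when (x ∈? C) + z j when (x ≟ j)
              pointwise x with x ≟ j
              ... | yes refl = ≤-reflexive (trans (cong (_+ w x) (when-yes (x ∈? C) j∈C))
                                 (trans (+-comm (z x) (w x)) (cong (_+ z x) (sym (when-yes (x ∈? C) j∈C)))))
              ... | no _ = +-monoˡ-≤ 0 (when-≤ʳ (x ∈? C) λ x∈C →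
                ≤-trans (z≤w x) (≤-reflexive (sym (when-yes (x ∈? C) x∈C))))

            -- A recorded least job k with key at least that of j stands in for j, because `z k` is
            -- at least `z j`. Otherwise the move of j is permitted, so terminality makes it
            -- blocked: the stuck jobs, alone or with an uncapped k, outweigh C by `zC+w≤11τ`; a
            -- capped k is worth 5τ, which is at least `z j`.
            visited : ¬ BigBlocked Bs i → zC ≤ zLoad i
            visited ¬bb with any? (λ k → leastBlocked? Bs i k ×-dec (key j ≤? key k))
            ... | yes (k , lb , j≤k) = ≤-trans zC≤stuck+z (≤-trans (+-monoʳ-≤ (stuckLoad σ Bs i)
                  (z-mono (proj₂ (leastBlocked-valid Bs v lb)) (key-≤⇒w-≤ j≤k)))
                  (stuck+big≤zLoad (proj₁ (proj₁ (leastBlocked-valid Bs v lb)))))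
            ... | no ∄k = outweighed (proj₂ term j i big act
                  (C⊆Γ j j∈C , off , ¬full , λ _ → ¬bb , λ k lb → ≰⇒> (λ j≤k → ∄k (k , lb , j≤k))))
              where
              outweighed : Blocked σ Bs j i → zC ≤ zLoad i
              outweighed (inj₁ over) = ≤-trans (+-cancelʳ-≤ (w j) _ _ (≤-trans zC+w≤11τ (<⇒≤ over))) (stuck≤zLoad i)
              outweighed (inj₂ (k , lb , over)) with leastBlocked-valid Bs v lb | w k ≤? 5 * τ
              ... | (kOn , _) , kAct | yes wk≤5τ = ≤-trans (+-cancelʳ-≤ (w j) _ _ (≤-trans zC+w≤11τ (<⇒≤ over)))
                    (≤-trans (+-monoʳ-≤ (stuckLoad σ Bs i)
                               (≤-reflexive (sym (trans (z-awake (inj₁ kAct)) (m≤n⇒m⊓n≡m wk≤5τ)))))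
                             (stuck+big≤zLoad kOn))
              ... | (kOn , _) , kAct | no wk≰5τ = ≤-trans zC≤stuck+z (≤-trans (+-monoʳ-≤ (stuckLoad σ Bs i)
                    (≤-trans (z≤5τ j) (≤-reflexive (sym (trans (z-awake (inj₁ kAct)) (m≥n⇒m⊓n≡n (<⇒≤ (≰⇒> wk≰5τ))))))))
                    (stuck+big≤zLoad kOn))

          -- Two active big jobs on i already contribute 6τ, the most any configuration can have.
          open-bound : zC ≤ zLoad i
          open-bound with bigBlocked? Bs i
          ... | yes blocked = twoBig (bigBlocked-valid Bs v blocked)
            where
            twoBig : TwoBig σ Bs i → zC ≤ zLoad i
            twoBig (k , k′ , k≢k′ , ((b , on) , a) , ((b′ , on′) , a′)) = begin
              zC             ≤⟨ light C wC≤6τ ⟩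
              6 * τ          ≡⟨ *-distribʳ-+ τ 3 3 ⟩
              3 * τ + 3 * τ  ≤⟨ +-mono-≤ (z-big a b) (z-big a′ b′) ⟩
              z k + z k′     ≤⟨ two-members z (on? σ i) k≢k′ on on′ ⟩
              zLoad i        ∎
              where open ≤-Reasoning
          ... | no ¬bb with any? (λ j → (j ∈? C) ×-dec active? σ Bs j ×-dec (3 * τ <? w j) ×-dec ¬? (on? σ i j))
          ...   | yes (j , j∈C , act , big , off) = visited j∈C act big off ¬bb
          ...   | no ∄j                           = local ∄j

        charge : {P : Set} → Fin m → Dec P → ℕ
        charge i (yes _) = 6 * τ
        charge i (no _)  = zLoad i

        -- The list is a parameter so that `amortised` can recurse on the older part of the stack
        -- while `zLoad` stays that of the whole one.
        y : List Blocker → Fin m → ℕ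
        y Bs′ i = charge i (full? Bs′ i)

        y-bound : ∀ i (C : Subset n) → (∀ j → j ∈ C → i ∈ Γ j) → ∑∣ w (_∈? C) ≤ 6 * τ → ∑∣ z (_∈? C) ≤ y Bs i
        y-bound i C C⊆Γ wC≤6τ with full? Bs i
        ... | yes _    = light C wC≤6τ
        ... | no ¬full = open-bound ¬full C⊆Γ wC≤6τ

        zLoad-full : ∀ i → Full Bs i →
                     fullLoad σ i ≤ zLoad i ⊎ (fullLoad σ i ≤ zLoad i + τ × 5 * τ ≤ zLoad i) ⊎ 10 * τ ≤ zLoad i
        zLoad-full i full = capped-sum _ _ pointwise
          where
          pointwise : ∀ x → w x when on? σ i x ≤ z x when on? σ i x ⊎
                      (w x when on? σ i x ≤ z x when on? σ i x + τ × 5 * τ ≤ z x when on? σ i x)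
          pointwise x with on? σ i x
          ... | no _ = inj₁ z≤n
          ... | yes on with z-awake (inj₁ (active-on-full σ Bs on full)) | w x ≤? 5 * τ
          ...   | eq | yes wx≤5τ = inj₁ (≤-reflexive (sym (trans eq (m≤n⇒m⊓n≡m wx≤5τ))))
          ...   | eq | no wx≰5τ rewrite trans eq (m≥n⇒m⊓n≡n (<⇒≤ (≰⇒> wx≰5τ))) =
                  inj₂ (≤-trans (w≤6τ x) (≤-reflexive (six τ)) , ≤-refl)
            where
            six : ∀ t → 6 * t ≡ 5 * t + t
            six = solve-∀

        sa-rich : ∀ i j → Full Bs i → Small j → 11 * τ < fullLoad σ i + w j → 7 * τ ≤ zLoad i
        sa-rich i j full small over = bound (zLoad-full i full)
          where
          8τ≤fullLoad : 8 * τ ≤ fullLoad σ i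
          8τ≤fullLoad = ≤-from-sum (+-mono-≤ (<⇒≤ over) small) (eq τ (fullLoad σ i) (w j))
            where
            eq : ∀ t l a → 8 * t + (l + a + 3 * t) ≡ l + (11 * t + a)
            eq = solve-∀
          bound : _ → 7 * τ ≤ zLoad i
          bound (inj₁ p)              = ≤-trans (*-monoˡ-≤ τ {7} {8} (n≤1+n 7)) (≤-trans 8τ≤fullLoad p)
          bound (inj₂ (inj₁ (p , _))) = ≤-from-sum (≤-trans 8τ≤fullLoad p) (eq τ (zLoad i))
            where
            eq : ∀ t l → 7 * t + (l + t) ≡ l + 8 * t
            eq = solve-∀
          bound (inj₂ (inj₂ p))       = ≤-trans (*-monoˡ-≤ τ {7} {10} (m≤m+n 7 3)) p

        ba-rich : ∀ i j → Full Bs i → 11 * τ < fullLoad σ i + w j → 5 * τ ≤ zLoad i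
        ba-rich i j full over = bound (zLoad-full i full)
          where
          5τ≤fullLoad : 5 * τ ≤ fullLoad σ i
          5τ≤fullLoad = ≤-from-sum (+-mono-≤ (<⇒≤ over) (w≤6τ j)) (eq τ (fullLoad σ i) (w j))
            where
            eq : ∀ t l a → 5 * t + (l + a + 6 * t) ≡ l + (11 * t + a)
            eq = solve-∀
          bound : _ → 5 * τ ≤ zLoad i
          bound (inj₁ p)              = ≤-trans 5τ≤fullLoad p
          -- One capped job alone is worth 5τ, so capping costs nothing here, unlike in `sa-rich`.
          bound (inj₂ (inj₁ (_ , p))) = p
          bound (inj₂ (inj₂ p))       = ≤-trans (*-monoˡ-≤ τ {5} {10} (m≤m+n 5 5)) p

        charge-yes : ∀ {P : Set} {i} (P? : Dec P) → P → charge i P? ≡ 6 * τ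
        charge-yes (yes _) p = refl
        charge-yes (no ¬p) p = contradiction p ¬p

        charge-no : ∀ {P : Set} {i} (P? : Dec P) → ¬ P → charge i P? ≡ zLoad i
        charge-no (yes p) ¬p = contradiction p ¬p
        charge-no (no _)  ¬p = refl

        charge-cong : ∀ {P Q : Set} {i} (P? : Dec P) (Q? : Dec Q) → (P → Q) → (Q → P) → charge i P? ≤ charge i Q?
        charge-cong (yes p) Q? to from = ≤-reflexive (sym (charge-yes Q? (to p)))
        charge-cong (no ¬p) Q? to from = ≤-reflexive (sym (charge-no Q? (¬p ∘ from)))

        -- Only the charge of i changes, from `zLoad i` to 6τ; both terms are moved across to avoid
        -- subtraction.
        charge-full : ∀ Bs′ i → ¬ Full Bs′ i →
                      ∑ (λ x → charge x ((x ≟ i) ⊎-dec full? Bs′ x)) + zLoad i ≤ ∑ (y Bs′) + 6 * τ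
        charge-full Bs′ i ¬full = begin
          ∑ y⁺ + zLoad i                               ≡⟨ cong (∑ y⁺ +_) (∑-at (zLoad i) i) ⟨
          ∑ y⁺ + ∑ (λ x → zLoad i when (x ≟ i))        ≡⟨ ∑-+ y⁺ _ ⟨
          ∑ (λ x → y⁺ x + zLoad i when (x ≟ i))        ≤⟨ ∑-mono (λ x → pointwise x (x ≟ i)) ⟩
          ∑ (λ x → y Bs′ x + (6 * τ) when (x ≟ i))     ≡⟨ ∑-+ (y Bs′) _ ⟩
          ∑ (y Bs′) + ∑ (λ x → (6 * τ) when (x ≟ i))   ≡⟨ cong (∑ (y Bs′) +_) (∑-at (6 * τ) i) ⟩
          ∑ (y Bs′) + 6 * τ                            ∎
          where
          open ≤-Reasoning
          y⁺ : Fin m → ℕ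
          y⁺ x = charge x ((x ≟ i) ⊎-dec full? Bs′ x)
          pointwise : ∀ x (x≟i : Dec (x ≡ i)) → y⁺ x + zLoad i when x≟i ≤ y Bs′ x + (6 * τ) when x≟i
          pointwise x (yes refl) rewrite charge-yes {i = i} ((x ≟ i) ⊎-dec full? Bs′ x) (inj₁ refl)
                                       | charge-no {i = i} (full? Bs′ i) ¬full = ≤-reflexive (+-comm (6 * τ) (zLoad i))
          pointwise x (no x≢i) = +-monoˡ-≤ 0 (charge-cong ((x ≟ i) ⊎-dec full? Bs′ x) (full? Bs′ x)
            (λ { (inj₁ eq) → contradiction eq x≢i ; (inj₂ full) → full }) inj₂)

        -- Charging 6τ instead of zLoad to a full machine saves τ per sa-blocker and costs at most τ per ba-blocker.
        amortised : ∀ Bs′ → Valid σ Bs′ → (∀ i → Full Bs′ i → Full Bs i) →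
                    ∑ (y Bs′) + #sa Bs′ * τ ≤ ∑ zLoad + #ba Bs′ * τ
        amortised [] _ _ = ≤-refl
        amortised (bb _ _ _ ∷ Bs′) (v′ , _) ⊆ = amortised Bs′ v′ ⊆
        amortised (bl _ _ _ ∷ Bs′) (v′ , _) ⊆ = amortised Bs′ v′ ⊆
        amortised (sa j i u ∷ Bs′) (v′ , (_ , _ , ¬full , _) , _ , small , over , _) ⊆ = ≤-from-sum
          (+-mono-≤ (+-mono-≤ (charge-full Bs′ i ¬full) (sa-rich i j (⊆ i (inj₁ refl)) small over))
                    (amortised Bs′ v′ (λ x → ⊆ x ∘ inj₂)))
          (eq (∑ (y (sa j i u ∷ Bs′))) (zLoad i) (∑ (y Bs′)) τ (#sa Bs′ * τ) (∑ zLoad) (#ba Bs′ * τ))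
          where
          eq : ∀ Y′ l Y t s L b → Y′ + (t + s) + (Y + 6 * t + l + (L + b)) ≡ L + b + (Y′ + l + 7 * t + (Y + s))
          eq = solve-∀
        amortised (ba j i u ∷ Bs′) (v′ , (_ , _ , ¬full , _) , _ , _ , _ , _ , over , _) ⊆ = ≤-from-sum
          (+-mono-≤ (+-mono-≤ (charge-full Bs′ i ¬full) (ba-rich i j (⊆ i (inj₁ refl)) over))
                    (amortised Bs′ v′ (λ x → ⊆ x ∘ inj₂)))
          (eq (∑ (y (ba j i u ∷ Bs′))) (zLoad i) (∑ (y Bs′)) τ (#sa Bs′ * τ) (∑ zLoad) (#ba Bs′ * τ))
          where
          eq : ∀ Y′ l Y t s L b → Y′ + s + (Y + 6 * t + l + (L + b)) ≡ L + (t + b) + (Y′ + l + 5 * t + (Y + s))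
          eq = solve-∀

        assigned-share : ∀ x → ∑ (λ i → z x when on? σ i x) ≤ z x
        assigned-share x with any? (λ i → on? σ i x)
        ... | no ∄i = ≤-trans (≤-reflexive (∑∣-none (λ _ → z x) (λ i → on? σ i x) (λ i on → ∄i (i , on)))) z≤n
        ... | yes (i₀ , on₀) = ≤-trans
          (∑-mono λ i → when-mono (on? σ i x) (i ≟ i₀) (λ on → just-injective (trans (sym on) on₀)))
          (≤-reflexive (∑-at (z x) i₀))

        zLoad+new≤z : ∑ zLoad + z new ≤ ∑ z
        zLoad+new≤z = begin
          ∑ zLoad + z new
            ≡⟨ cong₂ _+_ (∑-comm +-0-commutativeMonoid (λ i x → z x when on? σ i x)) (sym (∑-at (z new) new)) ⟩
          ∑ (λ x → ∑ (λ i → z x when on? σ i x)) + ∑ (λ x → z new when (x ≟ new))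
            ≡⟨ ∑-+ (λ x → ∑ (λ i → z x when on? σ i x)) _ ⟨
          ∑ (λ x → ∑ (λ i → z x when on? σ i x) + z new when (x ≟ new))
            ≤⟨ ∑-mono pointwise ⟩
          ∑ z ∎
          where
          open ≤-Reasoning
          pointwise : ∀ x → ∑ (λ i → z x when on? σ i x) + z new when (x ≟ new) ≤ z x
          pointwise x with x ≟ new
          ... | yes refl = ≤-reflexive (cong (_+ z x) (∑∣-none (λ _ → z x) (λ i → on? σ i x) (proj₁ (proj₂ st))))
          ... | no _     = ≤-trans (≤-reflexive (+-identityʳ _)) (assigned-share x)

        0<z-new : 0 < z new
        0<z-new = <-≤-trans (⊓-pres-m< 0<new (*-mono-< {0} {5} {0} {τ} (s≤s z≤n) 0<τ))
          (≤-reflexive (sym (z-awake (inj₁ (active-new σ Bs)))))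
          where
          0<τ : 0 < τ
          0<τ = n≢0⇒n>0 λ { refl → <⇒≱ 0<new (w≤6τ new) }

        -- In the sum of `dual`, `amortised`, `zLoad+new≤z` and the bound of `#ba` by `#sa`,
        -- everything cancels except `z new ≤ 0`.
        absurd : ⊥
        absurd = <⇒≱ 0<z-new (≤-from-sum (+-mono-≤ (+-mono-≤ (dual z (y Bs) y-bound) (amortised Bs v (λ _ f → f)))
          (+-mono-≤ zLoad+new≤z (*-monoˡ-≤ τ (proj₂ (#ba≤#sa Bs v) closed))))
          (eq (∑ z) (∑ (y Bs)) (#sa Bs * τ) (#ba Bs * τ) (∑ zLoad) (z new)))
          where
          eq : ∀ Z Y s b L e → e + (Y + (L + b) + (Z + s)) ≡ 0 + (Z + (Y + s) + (L + e + b))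
          eq = solve-∀

      insert : ∀ {σ} → State σ → Success
      insert st with run absurd [] (<-wellFounded _) st tt
      ... | inj₁ success = success
      ... | inj₂ ()

  -- Inserting all jobs

  module _ (dual : (z : Fin n → ℕ) (y : Fin m → ℕ) →
              (∀ i (C : Subset n) → (∀ j → j ∈ C → i ∈ Γ j) → ∑∣ w (_∈? C) ≤ 6 * τ → ∑∣ z (_∈? C) ≤ y i) →
              ∑ z ≤ ∑ y)
           (w≤6τ : ∀ j → w j ≤ 6 * τ) (Γ≠∅ : ∀ j → ∃ λ i → i ∈ Γ j) where

    schedule-all : ∀ js → ∃ λ σ → Feasible σ × (∀ j → j ∈ᴸ js → ∃ λ i → On σ i j)
    schedule-all [] = const nothing ,
      ((λ _ _ ()) , λ i → ≤-trans (≤-reflexive (∑∣-none w (on? (const nothing) i) (λ _ ()))) z≤n) , λ _ ()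
    schedule-all (new ∷ js) with schedule-all js
    ... | σ , feas , assigned with any? (λ i → on? σ i new) | 0 <? w new
    ...   | yes at | _ = σ , feas , λ { _ (here refl) → at ; j (there j∈js) → assigned j j∈js }
    ...   | no ∄i  | yes 0<w = map₂
            (map₂ λ f → λ { _ (here refl) → f _ (inj₂ refl) ; j (there j∈js) → f j (inj₁ j∈js) })
            (Insertion.Dual.insert new (_∈ᴸ js) dual w≤6τ 0<w (feas , (λ i on → ∄i (i , on)) , assigned))
    -- A job of size 0 has z-value 0 and would not violate the dual, but it fits on any allowed
    -- machine.
    ...   | no ∄i  | no w≡0  = move σ new i₀ , feasible-move feas (proj₂ (Γ≠∅ new)) light , assigned′
      where
      i₀ : Fin m
      i₀ = proj₁ (Γ≠∅ new)
      light : fullLoad σ i₀ + w new ≤ 11 * τ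
      light = ≤-trans (+-monoʳ-≤ (fullLoad σ i₀) (≮⇒≥ w≡0)) (≤-trans (≤-reflexive (+-identityʳ _)) (proj₂ feas i₀))
      assigned′ : ∀ j → j ∈ᴸ (new ∷ js) → ∃ λ i → On (move σ new i₀) i j
      assigned′ j j∈ with j ≟ new
      ... | yes refl = i₀ , move-at σ new i₀
      assigned′ j (here eq)    | no j≢new = contradiction eq j≢new
      assigned′ j (there j∈js) | no j≢new = map₂ (trans (move-away σ new i₀ j≢new)) (assigned j j∈js)

    schedule : ∃ λ σ → Feasible σ × (∀ j → ∃ λ i → On σ i j)
    schedule = map₂ (map₂ λ f j → f j (∈-allFin j)) (schedule-all (allFin n))

-- Clearing denominators and rational sums

import Data.Integer as ℤ
import Data.Integer.Properties as ℤ
open import Data.Nat using (zero; suc)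
import Data.Nat as ℕ
import Data.Nat.Properties as ℕ
open import Data.Rational using (ℚ; 0ℚ; _+_; _*_; _≤_; *≤*; mkℚ; nonNegative)
open import Data.Rational.Literals using (fromℤ)
open import Data.Rational.Properties
  using (toℚᵘ-injective; toℚᵘ-homo-+; toℚᵘ-homo-*; ≤-refl; ≤-reflexive; ≤ᵇ⇒≤; module ≤-Reasoning;
         +-mono-≤; +-identityˡ; +-0-commutativeMonoid; *-assoc; *-comm; *-distribˡ-+; *-identityʳ; *-zeroˡ; *-zeroʳ;
         *-monoˡ-≤-nonNeg; *-monoʳ-≤-nonNeg; *-cancelʳ-≤-pos)
import Data.Rational.Unnormalised as ℚᵘ
import Data.Rational.Unnormalised.Properties as ℚᵘ
open Sums

ι : ℕ → ℚ
ι k = fromℤ (ℤ.+ k)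

ι-+ : ∀ a b → ι (a ℕ.+ b) ≡ ι a + ι b
ι-+ a b = toℚᵘ-injective (ℚᵘ.≃-sym (ℚᵘ.≃-trans (toℚᵘ-homo-+ (ι a) (ι b))
  (ℚᵘ.*≡* (cong (ℤ._* ℤ.+ 1) (cong₂ ℤ._+_ (ℤ.*-identityʳ (ℤ.+ a)) (ℤ.*-identityʳ (ℤ.+ b)))))))

ι-* : ∀ a b → ι (a ℕ.* b) ≡ ι a * ι b
ι-* a b = toℚᵘ-injective (ℚᵘ.≃-sym (ℚᵘ.≃-trans (toℚᵘ-homo-* (ι a) (ι b))
  (ℚᵘ.*≡* (cong (ℤ._* ℤ.+ 1) (sym (ℤ.pos-* a b))))))

ι-mono : ∀ {a b} → a ℕ.≤ b → ι a ≤ ι b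
ι-mono {a} {b} a≤b = *≤* (subst₂ ℤ._≤_ (sym (ℤ.*-identityʳ (ℤ.+ a))) (sym (ℤ.*-identityʳ (ℤ.+ b))) (ℤ.+≤+ a≤b))

ι-cancel : ∀ {a b} → ι a ≤ ι b → a ℕ.≤ b
ι-cancel {a} {b} (*≤* p) = ℤ.drop‿+≤+ (subst₂ ℤ._≤_ (ℤ.*-identityʳ (ℤ.+ a)) (ℤ.*-identityʳ (ℤ.+ b)) p)

ι-clear : ∀ q → 0ℚ ≤ q → ∃ λ d → ∃ λ k → q * ι (suc d) ≡ ι k
ι-clear q@(mkℚ (ℤ.+ k) d _) _ = d , k , toℚᵘ-injective (ℚᵘ.≃-trans (toℚᵘ-homo-* q (ι (suc d)))
  (ℚᵘ.*≡* (trans (ℤ.*-identityʳ (ℤ.+ k ℤ.* ℤ.+ suc d)) (cong (λ e → ℤ.+ k ℤ.* ℤ.+ e) (sym (ℕ.*-identityʳ (suc d)))))))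
ι-clear (mkℚ ℤ.-[1+ _ ] _ _) (*≤* ())

rescale : ∀ q a b k → q * ι a ≡ ι k → q * ι (a ℕ.* b) ≡ ι (k ℕ.* b)
rescale q a b k eq = begin
  q * ι (a ℕ.* b)  ≡⟨ cong (q *_) (ι-* a b) ⟩
  q * (ι a * ι b)  ≡⟨ *-assoc q (ι a) (ι b) ⟨
  q * ι a * ι b    ≡⟨ cong (_* ι b) eq ⟩
  ι k * ι b        ≡⟨ ι-* k b ⟨
  ι (k ℕ.* b)      ∎
  where open ≡-Reasoning

common-denominator : ∀ n (f : Fin n → ℚ) → (∀ i → 0ℚ ≤ f i) → ∃ λ d → ∀ i → ∃ λ k → f i * ι (suc d) ≡ ι k
common-denominator zero    f f≥0 = 0 , λ ()
common-denominator (suc n) f f≥0 with ι-clear (f zero) (f≥0 zero) | common-denominator n (f ∘ suc) (f≥0 ∘ suc)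
-- Denominators are stored as predecessors; the successor of this one is `suc a * suc b` by
-- computation.
... | a , k , eq | b , rest = b ℕ.+ a ℕ.* suc b , λ where
    zero    → k ℕ.* suc b , rescale (f zero) (suc a) (suc b) k eq
    (suc i) → proj₁ (rest i) ℕ.* suc a ,
      trans (cong (λ e → f (suc i) * ι e) (ℕ.*-comm (suc a) (suc b)))
            (rescale (f (suc i)) (suc b) (suc a) (proj₁ (rest i)) (proj₂ (rest i)))

module _ {A : Set} where

  sumOver : (A → ℚ) → List A → ℚ
  sumOver f L = sumℚ (map f L)

  sumOver-mono : ∀ {f g : A → ℚ} L → (∀ a → f a ≤ g a) → sumOver f L ≤ sumOver g L
  sumOver-mono []      f≤g = ≤-refl
  sumOver-mono (a ∷ L) f≤g = +-mono-≤ (f≤g a) (sumOver-mono L f≤g)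

  sumOver-cong : ∀ {f g : A → ℚ} L → (∀ a → f a ≡ g a) → sumOver f L ≡ sumOver g L
  sumOver-cong []      f≡g = refl
  sumOver-cong (a ∷ L) f≡g = cong₂ _+_ (f≡g a) (sumOver-cong L f≡g)

  sumOver-* : ∀ c (f : A → ℚ) L → c * sumOver f L ≡ sumOver (λ a → c * f a) L
  sumOver-* c f []      = *-zeroʳ c
  sumOver-* c f (a ∷ L) = trans (*-distribˡ-+ c (f a) _) (cong (c * f a +_) (sumOver-* c f L))

  sumOver-zero : (L : List A) → sumOver (λ _ → 0ℚ) L ≡ 0ℚ
  sumOver-zero []      = refl
  sumOver-zero (a ∷ L) = trans (+-identityˡ _) (sumOver-zero L)

  sumOver-+ : ∀ (f g : A → ℚ) L → sumOver (λ a → f a + g a) L ≡ sumOver f L + sumOver g L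
  sumOver-+ f g []      = refl
  sumOver-+ f g (a ∷ L) = trans (cong (f a + g a +_) (sumOver-+ f g L))
    (interchange (CommutativeMonoid.commutativeSemigroup +-0-commutativeMonoid) (f a) (g a) _ _)

sumOver-comm : ∀ {A B : Set} (f : A → B → ℚ) L M →
               sumOver (λ a → sumOver (f a) M) L ≡ sumOver (λ b → sumOver (λ a → f a b) L) M
sumOver-comm f []      M = sym (sumOver-zero M)
sumOver-comm f (a ∷ L) M = trans (cong (sumOver (f a) M +_) (sumOver-comm f L M)) (sym (sumOver-+ (f a) _ M))

Σℚ-ι : ∀ {n} (f : Fin n → ℕ) → Σℚ (ι ∘ f) ≡ ι (∑ f)
Σℚ-ι f = trans (cong sumℚ (map-tabulate id (ι ∘ f))) (go f)
  where
  go : ∀ {n} (f : Fin n → ℕ) → sumℚ (tabulate (ι ∘ f)) ≡ ι (∑ f)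
  go {zero}  f = refl
  go {suc n} f = trans (cong (λ s → ι (f zero) + s) (go (f ∘ suc))) (sym (ι-+ (f zero) _))

if-∈ : ∀ {A : Set} {n} {j : Fin n} (C : Subset n) (x y : A) → j ∈ C → (if lookup C j then x else y) ≡ x
if-∈ C x y j∈C rewrite []=⇒lookup j∈C = refl

if-∉ : ∀ {A : Set} {n} {j : Fin n} (C : Subset n) (x y : A) → ¬ (j ∈ C) → (if lookup C j then x else y) ≡ y
if-∉ {j = j} C x y j∉C with lookup C j in eq
... | true  = contradiction (lookup⇒[]= j C eq) j∉C
... | false = refl

all-true : ∀ n (f : Fin n → Bool) → foldr _∧_ true (map f (allFin n)) ≡ true → ∀ j → f j ≡ true
all-true n f eq j = go n f (trans (sym (cong (foldr _∧_ true) (map-tabulate id f))) eq) j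
  where
  go : ∀ n (f : Fin n → Bool) → foldr _∧_ true (tabulate f) ≡ true → ∀ j → f j ≡ true
  go (suc n) f eq j with f zero in eq₀
  go (suc n) f eq zero    | true = eq₀
  go (suc n) f eq (suc j) | true = go n (f ∘ suc) eq j

-- The configuration-LP in scaled units

module Scaled {n m : ℕ} (I : Instance n m) (t : ℚ) (w : Fin n → ℕ) (τ d : ℕ)
              (p-scaled : ∀ j → Instance.p I j * ι (suc d) ≡ ι (w j)) (t-scaled : t * ι (suc d) ≡ ι (6 ℕ.* τ)) where

  open Instance I

  scale : ℚ
  scale = ι (suc d)

  scaled-sum : {P : Pred (Fin n) _} (P? : Decidable P) (b : Fin n → Bool) →
               (∀ j → (if b j then p j else 0ℚ) * scale ≡ ι (w j when P? j)) →
               Σℚ (λ j → if b j then p j else 0ℚ) * scale ≡ ι (∑∣ w P?)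
  scaled-sum P? b eq = begin
    Σℚ f * scale                    ≡⟨ *-comm (Σℚ f) scale ⟩
    scale * Σℚ f                    ≡⟨ sumOver-* scale f (allFin n) ⟩
    Σℚ (λ j → scale * f j)          ≡⟨ sumOver-cong (allFin n) (λ j → trans (*-comm scale (f j)) (eq j)) ⟩
    Σℚ (λ j → ι (w j when P? j))    ≡⟨ Σℚ-ι (λ j → w j when P? j) ⟩
    ι (∑∣ w P?)                     ∎
    where
    open ≡-Reasoning
    f : Fin n → ℚ
    f j = if b j then p j else 0ℚ

  configLoad-scaled : ∀ C → configLoad I C * scale ≡ ι (∑∣ w (_∈? C))
  configLoad-scaled C = scaled-sum (_∈? C) (lookup C) eq
    where
    eq : ∀ j → (if lookup C j then p j else 0ℚ) * scale ≡ ι (w j when (j ∈? C))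
    eq j with j ∈? C
    ... | yes j∈C = trans (cong (_* scale) (if-∈ C (p j) 0ℚ j∈C)) (p-scaled j)
    ... | no j∉C  = trans (cong (_* scale) (if-∉ C (p j) 0ℚ j∉C)) (*-zeroˡ scale)

  load-scaled : ∀ (σ : Fin n → Fin m) i → load I σ i * scale ≡ ι (∑∣ w (λ j → σ j ≟ i))
  load-scaled σ i = scaled-sum (λ j → σ j ≟ i) (λ j → ⌊ σ j ≟ i ⌋) eq
    where
    eq : ∀ j → (if ⌊ σ j ≟ i ⌋ then p j else 0ℚ) * scale ≡ ι (w j when (σ j ≟ i))
    eq j with σ j ≟ i
    ... | yes _ = p-scaled j
    ... | no _  = *-zeroˡ scale

  config-allowed : ∀ i C → isConfigᵇ I t i C ≡ true → ∀ j → j ∈ C → i ∈ Γ j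
  config-allowed i C eq j j∈C with allAllowedᵇ I i C in eqA
  ... | true = lookup⇒[]= i (Γ j) (trans (sym (if-∈ C (allowedᵇ I i j) true j∈C)) (all-true n _ eqA j))

  config-light : ∀ i C → isConfigᵇ I t i C ≡ true → ∑∣ w (_∈? C) ℕ.≤ 6 ℕ.* τ
  config-light i C eq with allAllowedᵇ I i C
  ... | true = ι-cancel (subst₂ _≤_ (configLoad-scaled C) t-scaled
    (*-monoʳ-≤-nonNeg scale {configLoad I C} {t} (≤ᵇ⇒≤ {configLoad I C} {t} (Equivalence.from T-≡ eq))))

  -- Weak duality by double counting the products of `z j` and `x i C` over j ∈ C: covering bounds
  -- the total from below, and the bound on each configuration with the machine capacities bounds it
  -- from above.
  dual : ConfigLPFeasible I t → (z : Fin n → ℕ) (y : Fin m → ℕ) →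
         (∀ i (C : Subset n) → (∀ j → j ∈ C → i ∈ Γ j) → ∑∣ w (_∈? C) ℕ.≤ 6 ℕ.* τ → ∑∣ z (_∈? C) ℕ.≤ y i) →
         ∑ z ℕ.≤ ∑ y
  dual (x , x≥0 , machine , cover) z y bound = ι-cancel (begin
    ι (∑ z)
      ≡⟨ Σℚ-ι z ⟨
    Σℚ (λ j → ι (z j))
      ≤⟨ sumOver-mono (allFin n) covered ⟩
    Σℚ (λ j → Σℚ (λ i → sumOver (λ C → term i C j) Cs))
      ≡⟨ sumOver-comm (λ j i → sumOver (λ C → term i C j) Cs) (allFin n) (allFin m) ⟩
    Σℚ (λ i → Σℚ (λ j → sumOver (λ C → term i C j) Cs))
      ≡⟨ sumOver-cong (allFin m) (λ i → sumOver-comm (λ j C → term i C j) (allFin n) Cs) ⟩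
    Σℚ (λ i → sumOver (λ C → Σℚ (term i C)) Cs)
      ≤⟨ sumOver-mono (allFin m) (λ i → sumOver-mono Cs (config i)) ⟩
    Σℚ (λ i → sumOver (λ C → ι (y i) * mass i C) Cs)
      ≤⟨ sumOver-mono (allFin m) capacity ⟩
    Σℚ (λ i → ι (y i))
      ≡⟨ Σℚ-ι y ⟩
    ι (∑ y) ∎)
    where
    open ≤-Reasoning
    Cs : List (Subset n)
    Cs = allSubsets n
    mass : Fin m → Subset n → ℚ
    mass i C = if isConfigᵇ I t i C then x i C else 0ℚ
    term : Fin m → Subset n → Fin n → ℚ
    term i C j = ι (z j) * (if isConfigᵇ I t i C then (if lookup C j then x i C else 0ℚ) else 0ℚ)
    covered : ∀ j → ι (z j) ≤ Σℚ (λ i → sumOver (λ C → term i C j) Cs)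
    covered j = subst₂ _≤_ (*-identityʳ (ι (z j)))
      (trans (sumOver-* (ι (z j)) _ (allFin m)) (sumOver-cong (allFin m) (λ i → sumOver-* (ι (z j)) _ Cs)))
      (*-monoˡ-≤-nonNeg (ι (z j)) (cover j))
    capacity : ∀ i → sumOver (λ C → ι (y i) * mass i C) Cs ≤ ι (y i)
    capacity i = subst₂ _≤_ (sumOver-* (ι (y i)) (mass i) Cs) (*-identityʳ (ι (y i)))
      (*-monoˡ-≤-nonNeg (ι (y i)) (machine i))
    config : ∀ i C → Σℚ (term i C) ≤ ι (y i) * mass i C
    config i C with isConfigᵇ I t i C in eq
    ... | false = ≤-reflexive (trans (sumOver-cong (allFin n) (λ j → *-zeroʳ (ι (z j))))
      (trans (sumOver-zero (allFin n)) (sym (*-zeroʳ (ι (y i))))))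
    ... | true  = begin
      Σℚ (λ j → ι (z j) * (if lookup C j then x i C else 0ℚ))   ≡⟨ sumOver-cong (allFin n) pull ⟩
      Σℚ (λ j → x i C * ι (z j when (j ∈? C)))                  ≡⟨ sumOver-* (x i C) _ (allFin n) ⟨
      x i C * Σℚ (λ j → ι (z j when (j ∈? C)))                  ≡⟨ cong (x i C *_) (Σℚ-ι (λ j → z j when (j ∈? C))) ⟩
      x i C * ι (∑∣ z (_∈? C))                                  ≤⟨ *-monoˡ-≤-nonNeg (x i C) {{nonNegative (x≥0 i C)}}
        (ι-mono (bound i C (config-allowed i C eq) (config-light i C eq))) ⟩
      x i C * ι (y i)                                           ≡⟨ *-comm (x i C) (ι (y i)) ⟩
      ι (y i) * x i C                                           ∎
      where
      pull : ∀ j → ι (z j) * (if lookup C j then x i C else 0ℚ) ≡ x i C * ι (z j when (j ∈? C))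
      pull j with j ∈? C
      ... | yes j∈C = trans (cong (ι (z j) *_) (if-∈ C (x i C) 0ℚ j∈C)) (*-comm (ι (z j)) (x i C))
      ... | no j∉C  = trans (cong (ι (z j) *_) (if-∉ C (x i C) 0ℚ j∉C))
        (trans (*-zeroʳ (ι (z j))) (sym (*-zeroʳ (x i C))))

  -- A job larger than 6τ lies in no configuration, so its indicator vector would violate the dual bound.
  w≤6τ : ConfigLPFeasible I t → ∀ j → w j ℕ.≤ 6 ℕ.* τ
  w≤6τ lp j = ℕ.≮⇒≥ λ 6τ<w → contradiction
    (dual lp (λ x → 1 when (x ≟ j)) (λ _ → 0) λ i C _ light → absent C λ j∈C →
      ℕ.<⇒≱ 6τ<w (ℕ.≤-trans (∑∣-member w (_∈? C) j∈C) light))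
    (ℕ.<⇒≱ (subst₂ ℕ._<_ (sym (∑-zero m)) (sym (∑-at 1 j)) (ℕ.s≤s ℕ.z≤n)))
    where
    absent : ∀ C → ¬ (j ∈ C) → ∑∣ (λ x → 1 when (x ≟ j)) (_∈? C) ℕ.≤ 0
    absent C j∉C = ℕ.≤-trans (∑-mono λ x → when-≤ʳ (x ∈? C) λ x∈C → when-≤ʳ (x ≟ j) λ { refl → contradiction x∈C j∉C })
      (ℕ.≤-reflexive (∑-zero n))

  round : (s : Schedule I) → (∀ i → ∑∣ w (λ j → proj₁ s j ≟ i) ℕ.≤ 11 ℕ.* τ) →
          MakespanAtMost I (proj₁ s) (elevenSixths * t)
  round (σ , _) light i = *-cancelʳ-≤-pos scale (begin
    load I σ i * scale                 ≡⟨ load-scaled σ i ⟩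
    ι (∑∣ w (λ j → σ j ≟ i))           ≤⟨ ι-mono (light i) ⟩
    ι (11 ℕ.* τ)                       ≡⟨ ι-* 11 τ ⟩
    -- `elevenSixths * ι 6` evaluates to `ι 11`.
    elevenSixths * ι 6 * ι τ           ≡⟨ *-assoc elevenSixths (ι 6) (ι τ) ⟩
    elevenSixths * (ι 6 * ι τ)         ≡⟨ cong (elevenSixths *_) (trans (sym (ι-* 6 τ)) (sym t-scaled)) ⟩
    elevenSixths * (t * scale)         ≡⟨ *-assoc elevenSixths t scale ⟨
    elevenSixths * t * scale           ∎)
    where open ≤-Reasoning

theorem1 : (n m : ℕ) (I : Instance n m) (T : ℚ) → 0ℚ ≤ T → ConfigLPFeasible I T →
    ∃ λ (s : Schedule I) → MakespanAtMost I (Σ.proj₁ s) (elevenSixths * T)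
theorem1 n m I T 0≤T lp = s , round s light
  where
  open Instance I
  cleared : ∃ λ d → ∀ i → ∃ λ k → _
  cleared = common-denominator (suc n) (λ { zero → T ; (suc j) → p j }) (λ { zero → 0≤T ; (suc j) → p≥0 j })
  d τ : ℕ
  d = proj₁ cleared
  τ = proj₁ (proj₂ cleared zero)
  w : Fin n → ℕ
  w j = proj₁ (proj₂ cleared (suc j)) ℕ.* 6
  -- Besides the common denominator `suc d`, everything is multiplied by 6 so that T becomes exactly
  -- 6τ; `5 + d * 6` is the predecessor of `suc d * 6`.
  open Scaled I T w τ (5 ℕ.+ d ℕ.* 6) (λ j → rescale (p j) (suc d) 6 _ (proj₂ (proj₂ cleared (suc j))))
    (trans (rescale T (suc d) 6 τ (proj₂ (proj₂ cleared zero))) (cong ι (ℕ.*-comm τ 6)))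
  open Search w Γ τ using (On; Partial; Feasible; schedule; on?)
  found : ∃ λ (σ : Partial) → Feasible σ × (∀ j → ∃ λ i → On σ i j)
  found = schedule (dual lp) (w≤6τ lp) Γ≠∅
  s : Schedule I
  s = (λ j → proj₁ (proj₂ (proj₂ found) j)) , λ j → proj₁ (proj₁ (proj₂ found)) j _ (proj₂ (proj₂ (proj₂ found) j))
  light : ∀ i → ∑∣ w (λ j → proj₁ s j ≟ i) ℕ.≤ 11 ℕ.* τ
  light i = ℕ.≤-trans (ℕ.≤-reflexive (∑∣-cong w (λ j → proj₁ s j ≟ i) (on? (proj₁ found) i)
    (λ j eq → trans (proj₂ (proj₂ (proj₂ found) j)) (cong just eq))
    (λ j on → just-injective (trans (sym (proj₂ (proj₂ (proj₂ found) j))) on)))) (proj₂ (proj₁ (proj₂ found)) i)
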